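{- Let $G$ be a strongly connected Eulerian ribbon digraph, let $r\in V(G)$, and let $\overrightarrow{rw}\in E(G)$. Then every linear equivalence class of divisor-and-rotor configurations $(x,\varrho)$ on $G$ with $\deg(x)=0$ contains exactly one $\overrightarrow{rw}$-good configuration.
   Context: A digraph here is strongly connected, may have multiple edges, and has no loops; it is Eulerian if every vertex has in-degree equal to out-degree. A ribbon digraph is a digraph with, for each vertex $v$, a fixed cyclic ordering of the edges leaving $v$; $e^+$ denotes the edge after $e$. A divisor is $x\in\mathbb{Z}^{V(G)}$ with $\deg(x)=\sum_v x(v)$. A rotor configuration $\varrho$ assigns to each vertex $v$ an edge $\varrho(v)$ with tail $v$. A divisor-and-rotor configuration (DRC) is a pair $(x,\varrho)$. Routing at $v$ (unconstrained, i.e. with no condition on $x(v)$) transforms $(x,\varrho)$ into $(x',\varrho')$ with $\varrho'(v)=\varrho(v)^+$, $\varrho'(u)=\varrho(u)$ for $u\ne v$, and $x'=x-\mathbf{1}_v+\mathbf{1}_{v'}$ where $v'$ is the head of $\varrho(v)^+$. Two DRCs are linearly equivalent if one can be reached from the other by a sequence of such routings. A spanning in-arborescence rooted at $r$ is a subdigraph in which each $v\neq r$ has out-degree exactly one and whose underlying undirected graph is a spanning tree. A DRC is $\overrightarrow{rw}$-good if it has the form $(\mathbf{0},\varrho)$ with $\varrho(r)=\overrightarrow{rw}$ and $\{\varrho(v):v\in V(G)-r\}$ a spanning in-arborescence rooted at $r$. -}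

module Defs where

open import Level using (0ℓ)
open import Data.Nat using (ℕ; zero; suc; _∸_)
open import Data.Fin using (Fin; _≟_)
open import Data.Fin.Properties using (any?)
open import Data.Integer using (ℤ; _+_; _-_; 0ℤ; 1ℤ)
open import Data.List using (List; length; filter; foldr; map)
open import Data.List.Base using (allFin)
open import Data.Product using (Σ; ∃; _×_; _,_)
open import Data.Product.Properties using ()
open import Data.Sum using (_⊎_)
open import Data.Bool using (if_then_else_)
open import Relation.Nullary using (¬_; does)
open import Relation.Nullary.Decidable using (¬?; _×-dec_)
open import Relation.Unary using (Pred; Decidable)
open import Relation.Binary.PropositionalEquality using (_≡_; _≢_)
open import Relation.Binary.Construct.Closure.ReflexiveTransitive using (Star)
open import Function.Definitions using (Injective)

iter : {A : Set} → (A → A) → ℕ → A → A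
iter f zero a = a
iter f (suc k) a = f (iter f k a)

record Digraph : Set where
  field
    n    : ℕ
    m    : ℕ
    tail : Fin m → Fin n
    head : Fin m → Fin n

-- Ribbon digraph: for each vertex v a cyclic ordering of the edges leaving v,
-- encoded by the successor map e ↦ e⁺ which is an injective map preserving
-- tails whose restriction to the out-edges of each vertex is a single cycle.
record RibbonDigraph : Set where
  field
    graph : Digraph
  open Digraph graph public
  field
    next      : Fin m → Fin m
    next-tail : ∀ e → tail (next e) ≡ tail e
    next-inj  : Injective _≡_ _≡_ next
    next-cyc  : ∀ e e′ → tail e ≡ tail e′ → ∃ λ k → iter next k e ≡ e′

module _ (D : Digraph) where
  open Digraph D

  NoLoops : Set
  NoLoops = ∀ e → tail e ≢ head e

  data Reach (u : Fin n) : Fin n → Set where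
    here : Reach u u
    step : ∀ {v} e → Reach u (tail e) → head e ≡ v → Reach u v

  StronglyConnected : Set
  StronglyConnected = ∀ u v → Reach u v

  countE : {P : Pred (Fin m) 0ℓ} → Decidable P → ℕ
  countE P? = length (filter P? (allFin m))

  indeg outdeg : Fin n → ℕ
  indeg v = countE (λ e → head e ≟ v)
  outdeg v = countE (λ e → tail e ≟ v)

  Eulerian : Set
  Eulerian = ∀ v → indeg v ≡ outdeg v

  data UReach (S : Pred (Fin m) 0ℓ) (u : Fin n) : Fin n → Set where
    here : UReach S u u
    fwd  : ∀ {v} e → S e → UReach S u (tail e) → head e ≡ v → UReach S u v
    bwd  : ∀ {v} e → S e → UReach S u (head e) → tail e ≡ v → UReach S u v

  IsSpanningTree : {S : Pred (Fin m) 0ℓ} → Decidable S → Set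
  IsSpanningTree {S} S? = (countE S? ≡ n ∸ 1) × (∀ u v → UReach S u v)

  IsSpanningInArborescence : Fin n → {S : Pred (Fin m) 0ℓ} → Decidable S → Set
  IsSpanningInArborescence r {S} S? =
    (∀ v → v ≢ r → countE (λ e → S? e ×-dec (tail e ≟ v)) ≡ 1) × IsSpanningTree S?

module _ (G : RibbonDigraph) where
  open RibbonDigraph G

  Divisor : Set
  Divisor = Fin n → ℤ

  deg : Divisor → ℤ
  deg x = foldr _+_ 0ℤ (map x (allFin n))

  record Rotor : Set where
    field
      ρ     : Fin n → Fin m
      ρ-tail : ∀ v → tail (ρ v) ≡ v

  DRC : Set
  DRC = Divisor × Rotor

  ind : Fin n → Fin n → ℤ
  ind v w = if does (w ≟ v) then 1ℤ else 0ℤ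

  -- unconstrained routing at v
  route : Fin n → DRC → DRC
  route v (x , rot) = x′ , record { ρ = ρ′ ; ρ-tail = ρ′-tail }
    where
      open Rotor rot
      e⁺ = next (ρ v)
      v′ = head e⁺
      x′ : Divisor
      x′ w = x w - ind v w + ind v′ w
      ρ′ : Fin n → Fin m
      ρ′ u = if does (u ≟ v) then e⁺ else ρ u
      ρ′-tail : ∀ u → tail (ρ′ u) ≡ u
      ρ′-tail u with u ≟ v
      ... | Relation.Nullary.yes Relation.Binary.PropositionalEquality.refl =
              Relation.Binary.PropositionalEquality.trans (next-tail (ρ u)) (ρ-tail u)
      ... | Relation.Nullary.no _ = ρ-tail u

  RoutesTo : DRC → DRC → Set
  RoutesTo c c′ = ∃ λ v → route v c ≡ c′

  LinEquiv : DRC → DRC → Set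
  LinEquiv c d = Star RoutesTo c d ⊎ Star RoutesTo d c

  _≈DRC_ : DRC → DRC → Set
  (x , r₁) ≈DRC (y , r₂) = (∀ v → x v ≡ y v) × (∀ v → Rotor.ρ r₁ v ≡ Rotor.ρ r₂ v)

  rotorEdges : Rotor → Fin n → Pred (Fin m) 0ℓ
  rotorEdges rot r e = ∃ λ v → (v ≢ r) × (Rotor.ρ rot v ≡ e)

  rotorEdges? : (rot : Rotor) (r : Fin n) → Decidable (rotorEdges rot r)
  rotorEdges? rot r e = any? (λ v → ¬? (v ≟ r) ×-dec (Rotor.ρ rot v ≟ e))

  -- (x, ρ) is rw-good, where the edge rw is given by e (tail e = r)
  Good : (r : Fin n) (e : Fin m) → DRC → Set
  Good r e (x , rot) =
    (∀ v → x v ≡ 0ℤ) × (Rotor.ρ rot r ≡ e) ×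
    IsSpanningInArborescence graph r (rotorEdges? rot r)

module Submission where

-- Routing is analysed through firing vectors k : V → ℕ: `fire k` routes every
-- vertex u exactly k(u) times, and any routing sequence is such a firing.  Routing
-- a vertex through a full turn of its rotor (out-degree many routings) returns
-- the rotor and sends one chip along each out-edge; on an Eulerian digraph
-- firing every vertex N full turns is therefore the identity, which makes linear
-- equivalence symmetric and lets firing vectors be reduced modulo full turns.
--
-- Uniqueness: two rw-good configurations are related by a firing that keeps every
-- chip count.  After stripping full turns, a flow-counting argument over the set
-- of vertices that have not completed a turn shows that the root completes no
-- turn, and then, since rotor walks lead to the root, no vertex routes at all.
--
-- Existence: turn the rotor at r to rw; fire whole turns weighted geometrically by
-- the distance from r so that every v ≠ r holds a chip; then route chips away
-- from v ≠ r while possible.  The routings are bounded in terms of the distance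
-- to r, and the invariant "every rotor walk meets r or a chip" makes the final
-- rotors an in-arborescence; degree 0 leaves no chip on r.

open import Level using (0ℓ)
open import Defs
open import Data.Nat using (ℕ; zero; suc; _+_; _*_; _∸_; _^_; _≤_; _<_; z≤n; s≤s; _≤?_; _<?_; NonZero; >-nonZero)
open import Data.Nat.Properties hiding (_≟_)
open import Data.Nat.DivMod using (_/_; _%_; m≡m%n+[m/n]*n; m%n<n)
open import Data.Nat.Induction using (<-wellFounded)
open import Data.Nat.Tactic.RingSolver using (solve-∀)
open import Data.Fin using (Fin; zero; suc; _≟_)
open import Data.Fin.Properties using (all?; any?; ¬∀⟶∃¬)
open import Data.Integer using (ℤ; +_; -[1+_]; 0ℤ; 1ℤ; ∣_∣; +≤+)
  renaming (_+_ to _+ℤ_; _-_ to _-ℤ_; _≤_ to _≤ℤ_; _<_ to _<ℤ_; _<?_ to _<ℤ?_)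
import Data.Integer.Properties as ℤP
open import Data.Integer.Tactic.RingSolver using () renaming (solve-∀ to solveℤ)
open import Algebra.Properties.Semiring.Sum +-*-semiring
  using (sum; sum-cong-≗; ∑-distrib-+; ∑-comm; *-distribˡ-sum; sum-replicate-zero)
open import Algebra.Properties.Semiring.Sum ℤP.+-*-semiring using ()
  renaming (sum to sumℤ; sum-cong-≗ to sumℤ-cong; ∑-distrib-+ to sumℤ-+; sum-replicate-zero to sumℤ-zero)
open import Data.Bool using (true; false; if_then_else_)
open import Data.Empty using (⊥-elim)
open import Data.Product using (Σ; _×_; _,_; proj₁; proj₂)
open import Data.Sum using (_⊎_; inj₁; inj₂)
open import Data.List using (List; []; _∷_; length; filter; foldr; tabulate) renaming (map to lmap)
open import Data.List.Base using (allFin)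
open import Function using (_∘_; id)
open import Induction.WellFounded using (Acc; acc)
open import Relation.Nullary using (Dec; yes; no; does; ¬_)
open import Relation.Nullary.Decidable using (¬?; _×-dec_; _⊎-dec_)
open import Relation.Unary using (Pred; Decidable)
open import Relation.Binary.PropositionalEquality
open import Relation.Binary.Construct.Closure.ReflexiveTransitive using (Star; _◅_; _◅◅_) renaming (ε to done)

infixr 5 _■_
_■_ : ∀ {a} {A : Set a} {x y z : A} → x ≡ y → y ≡ z → x ≡ z
_■_ = trans

⟦_⟧ : ∀ {ℓ} {A : Set ℓ} → Dec A → ℕ
⟦ d ⟧ = if does d then 1 else 0

⟦⟧-yes : ∀ {ℓ} {A : Set ℓ} (d : Dec A) → A → ⟦ d ⟧ ≡ 1
⟦⟧-yes (yes _) _ = refl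
⟦⟧-yes (no ¬a) a = ⊥-elim (¬a a)

⟦⟧-no : ∀ {ℓ} {A : Set ℓ} (d : Dec A) → ¬ A → ⟦ d ⟧ ≡ 0
⟦⟧-no (yes a) ¬a = ⊥-elim (¬a a)
⟦⟧-no (no _) _ = refl

⟦⟧≡1⇒ : ∀ {ℓ} {A : Set ℓ} (d : Dec A) → ⟦ d ⟧ ≡ 1 → A
⟦⟧≡1⇒ (yes a) _ = a
⟦⟧≡1⇒ (no _) ()

⟦⟧≡0⇒ : ∀ {ℓ} {A : Set ℓ} (d : Dec A) → ⟦ d ⟧ ≡ 0 → ¬ A
⟦⟧≡0⇒ (yes _) ()
⟦⟧≡0⇒ (no ¬a) _ = ¬a

⟦⟧≤1 : ∀ {ℓ} {A : Set ℓ} (d : Dec A) → ⟦ d ⟧ ≤ 1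
⟦⟧≤1 (yes _) = s≤s z≤n
⟦⟧≤1 (no _) = z≤n

⟦⟧-⇔ : ∀ {ℓ ℓ′} {A : Set ℓ} {B : Set ℓ′} (d : Dec A) (d′ : Dec B) →
       (A → B) → (B → A) → ⟦ d ⟧ ≡ ⟦ d′ ⟧
⟦⟧-⇔ (yes a) (yes b) f g = refl
⟦⟧-⇔ (yes a) (no ¬b) f g = ⊥-elim (¬b (f a))
⟦⟧-⇔ (no ¬a) (yes b) f g = ⊥-elim (¬a (g b))
⟦⟧-⇔ (no _) (no _) f g = refl

⟦≟⟧-sym : ∀ {k} (a b : Fin k) → ⟦ a ≟ b ⟧ ≡ ⟦ b ≟ a ⟧
⟦≟⟧-sym a b = ⟦⟧-⇔ (a ≟ b) (b ≟ a) sym sym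

⟦⟧-× : ∀ {a b} {A : Set a} {B : Set b} (d : Dec (A × B)) (p : Dec A) (q : Dec B) →
       ⟦ d ⟧ ≡ ⟦ p ⟧ * ⟦ q ⟧
⟦⟧-× (yes _) (yes _) (yes _) = refl
⟦⟧-× (yes (a , _)) (no ¬a) _ = ⊥-elim (¬a a)
⟦⟧-× (yes (_ , b)) (yes _) (no ¬b) = ⊥-elim (¬b b)
⟦⟧-× (no _) (no _) _ = refl
⟦⟧-× (no _) (yes _) (no _) = refl
⟦⟧-× (no ¬ab) (yes a) (yes b) = ⊥-elim (¬ab (a , b))

⟦⟧-¬ : ∀ {a} {A : Set a} (d : Dec A) (nd : Dec (¬ A)) → ⟦ nd ⟧ + ⟦ d ⟧ ≡ 1
⟦⟧-¬ (yes a) (yes na) = ⊥-elim (na a)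
⟦⟧-¬ (yes a) (no _) = refl
⟦⟧-¬ (no _) (yes _) = refl
⟦⟧-¬ (no na) (no nna) = ⊥-elim (nna na)

if-yes : ∀ {a b} {A : Set a} {B : Set b} (d : Dec A) {p q : B} → A → (if does d then p else q) ≡ p
if-yes (yes _) _ = refl
if-yes (no na) a = ⊥-elim (na a)

if-no : ∀ {a b} {A : Set a} {B : Set b} (d : Dec A) {p q : B} → ¬ A → (if does d then p else q) ≡ q
if-no (yes a) na = ⊥-elim (na a)
if-no (no _) _ = refl

sum-ones : ∀ {k} → sum {k} (λ _ → 1) ≡ k
sum-ones {zero} = refl
sum-ones {suc k} = cong suc (sum-ones {k})

sum-mono-≤ : ∀ {k} {f g : Fin k → ℕ} → (∀ i → f i ≤ g i) → sum f ≤ sum g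
sum-mono-≤ {zero} h = z≤n
sum-mono-≤ {suc k} h = +-mono-≤ (h zero) (sum-mono-≤ (h ∘ suc))

sum-mono-< : ∀ {k} {f g : Fin k → ℕ} → (∀ i → f i ≤ g i) → ∀ j → f j < g j → sum f < sum g
sum-mono-< h zero lt = +-mono-<-≤ lt (sum-mono-≤ (h ∘ suc))
sum-mono-< h (suc j) lt = +-mono-≤-< (h zero) (sum-mono-< (h ∘ suc) j lt)

term≤sum : ∀ {k} (f : Fin k → ℕ) (j : Fin k) → f j ≤ sum f
term≤sum f zero = m≤m+n _ _
term≤sum f (suc j) = ≤-trans (term≤sum (f ∘ suc) j) (m≤n+m _ _)

sum-δ : ∀ {k} (a : Fin k) (f : Fin k → ℕ) → sum (λ i → ⟦ a ≟ i ⟧ * f i) ≡ f a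
sum-δ {suc k} zero f = cong (λ z → f zero + 0 + z) (sum-replicate-zero k) ■ +-identityʳ _ ■ +-identityʳ _
sum-δ {suc k} (suc a) f = sum-δ a (f ∘ suc)

sum-δ1 : ∀ {k} (a : Fin k) → sum (λ i → ⟦ a ≟ i ⟧) ≡ 1
sum-δ1 a = sum-cong-≗ (λ i → sym (*-identityʳ ⟦ a ≟ i ⟧)) ■ sum-δ a (λ _ → 1)

sum-fibres : ∀ {k l} (h : Fin k → Fin l) (F : Fin l → ℕ) (g : Fin k → ℕ) →
             sum (λ i → F (h i) * g i) ≡ sum (λ w → F w * sum (λ i → ⟦ h i ≟ w ⟧ * g i))
sum-fibres h F g =
  sum-cong-≗ (λ i → sym (sum-δ (h i) (λ w → F w * g i)))
  ■ ∑-comm (λ i w → ⟦ h i ≟ w ⟧ * (F w * g i))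
  ■ sum-cong-≗ (λ w → sum-cong-≗ (λ i → rearrange ⟦ h i ≟ w ⟧ (F w) (g i))
                       ■ sym (*-distribˡ-sum (F w) (λ i → ⟦ h i ≟ w ⟧ * g i)))
  where
    rearrange : ∀ a b c → a * (b * c) ≡ b * (a * c)
    rearrange = solve-∀

length-filter : ∀ {A : Set} {P : Pred A 0ℓ} (P? : Decidable P) {k} (f : Fin k → A) →
                length (filter P? (tabulate f)) ≡ sum (λ i → ⟦ P? (f i) ⟧)
length-filter P? {zero} f = refl
length-filter P? {suc k} f with does (P? (f zero))
... | true = cong suc (length-filter P? (f ∘ suc))
... | false = length-filter P? (f ∘ suc)

sumℤ-- : ∀ {k} (f g : Fin k → ℤ) → sumℤ (λ i → f i -ℤ g i) ≡ sumℤ f -ℤ sumℤ g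
sumℤ-- {zero} f g = refl
sumℤ-- {suc k} f g = cong (f zero -ℤ g zero +ℤ_) (sumℤ-- (f ∘ suc) (g ∘ suc)) ■ interchange (f zero) (g zero) _ _
  where
    interchange : ∀ a b c d → (a -ℤ b) +ℤ (c -ℤ d) ≡ (a +ℤ c) -ℤ (b +ℤ d)
    interchange = solveℤ

sumℤ-at : ∀ {k} (a : Fin k) (f : Fin k → ℤ) → sumℤ (λ w → if does (w ≟ a) then f w else 0ℤ) ≡ f a
sumℤ-at {suc k} zero f = cong (f zero +ℤ_) (sumℤ-zero k) ■ ℤP.+-identityʳ (f zero)
sumℤ-at {suc k} (suc a) f = ℤP.+-identityˡ _ ■ sumℤ-at a (f ∘ suc)

le-add : ∀ a {b} → 0ℤ ≤ℤ b → a ≤ℤ a +ℤ b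
le-add a h = ℤP.≤-trans (ℤP.≤-reflexive (sym (ℤP.+-identityʳ a))) (ℤP.+-monoʳ-≤ a h)

le-addˡ : ∀ {a} b → 0ℤ ≤ℤ a → b ≤ℤ a +ℤ b
le-addˡ {a} b h = subst (_≤ℤ a +ℤ b) (ℤP.+-identityˡ b) (ℤP.+-monoˡ-≤ b h)

sumℤ-nonneg : ∀ {k} (g : Fin k → ℤ) → (∀ i → 0ℤ ≤ℤ g i) → 0ℤ ≤ℤ sumℤ g
sumℤ-nonneg {zero} g h = ℤP.≤-refl
sumℤ-nonneg {suc k} g h = ℤP.≤-trans (h zero) (le-add (g zero) (sumℤ-nonneg (g ∘ suc) (h ∘ suc)))

term≤sumℤ : ∀ {k} (g : Fin k → ℤ) → (∀ i → 0ℤ ≤ℤ g i) → ∀ j → g j ≤ℤ sumℤ g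
term≤sumℤ {suc k} g h zero = le-add (g zero) (sumℤ-nonneg (g ∘ suc) (h ∘ suc))
term≤sumℤ {suc k} g h (suc j) =
  ℤP.≤-trans (term≤sumℤ (g ∘ suc) (h ∘ suc) j) (le-addˡ (sumℤ (g ∘ suc)) (h zero))

foldr≡sumℤ : ∀ {k} (x : Fin k → ℤ) → foldr _+ℤ_ 0ℤ (lmap x (allFin k)) ≡ sumℤ x
foldr≡sumℤ x = go x id
  where
    go : ∀ {k l} (x : Fin l → ℤ) (f : Fin k → Fin l) →
         foldr _+ℤ_ 0ℤ (lmap x (tabulate f)) ≡ sumℤ (x ∘ f)
    go {zero} x f = refl
    go {suc k} x f = cong (x (f zero) +ℤ_) (go x (f ∘ suc))

module _ {A : Set} (f : A → A) where
  iter-suc : ∀ k a → iter f (suc k) a ≡ iter f k (f a)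
  iter-suc zero a = refl
  iter-suc (suc k) a = cong f (iter-suc k a)

  iter-+ : ∀ a b x → iter f (a + b) x ≡ iter f a (iter f b x)
  iter-+ zero b x = refl
  iter-+ (suc a) b x = cong f (iter-+ a b x)

  iter-period : ∀ p x → iter f p x ≡ x → ∀ N → iter f (N * p) x ≡ x
  iter-period p x h zero = refl
  iter-period p x h (suc N) = iter-+ p (N * p) x ■ cong (iter f p) (iter-period p x h N) ■ h

  iter-injective : (∀ {a b} → f a ≡ f b → a ≡ b) → ∀ k {a b} → iter f k a ≡ iter f k b → a ≡ b
  iter-injective inj zero eq = eq
  iter-injective inj (suc k) eq = iter-injective inj k (inj eq)

iter-cong : ∀ {A : Set} {f g : A → A} → (∀ a → f a ≡ g a) → ∀ j a → iter f j a ≡ iter g j a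
iter-cong h zero a = refl
iter-cong {f = f} h (suc j) a = cong f (iter-cong h j a) ■ h _

orbit-exit : ∀ {k} {P : Fin k → Set} (P? : ∀ a → Dec (P a)) (f : Fin k → Fin k) →
             ∀ j a → P a → ¬ P (iter f j a) → Σ (Fin k) λ b → P b × ¬ P (f b)
orbit-exit P? f zero a pa npa = ⊥-elim (npa pa)
orbit-exit P? f (suc j) a pa np with P? (iter f j a)
... | yes p = iter f j a , p , np
... | no q = orbit-exit P? f j a pa q

module _ (P : ℕ → Set) (P? : ∀ i → Dec (P i)) where
  Least : Set
  Least = Σ ℕ λ l → P l × (∀ i → P i → l ≤ i)

  private
    search : ∀ b → Least ⊎ (∀ i → i ≤ b → ¬ P i)
    search zero with P? 0
    ... | yes p = inj₁ (0 , p , λ _ _ → z≤n)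
    ... | no ¬p = inj₂ λ { .zero z≤n → ¬p }
    search (suc b) with search b
    ... | inj₁ found = inj₁ found
    ... | inj₂ none with P? (suc b)
    ... | yes p = inj₁ (suc b , p , above)
      where
        above : ∀ i → P i → suc b ≤ i
        above i pi with i ≤? b
        ... | yes i≤b = ⊥-elim (none i i≤b pi)
        ... | no i≰b = ≰⇒> i≰b
    ... | no ¬p = inj₂ below
      where
        below : ∀ i → i ≤ suc b → ¬ P i
        below i i≤sb pi with i ≤? b
        ... | yes i≤b = none i i≤b pi
        ... | no i≰b = ¬p (subst P (≤-antisym i≤sb (≰⇒> i≰b)) pi)

  least : ∀ b → P b → Least
  least b pb with search b
  ... | inj₁ found = found
  ... | inj₂ none = ⊥-elim (none b ≤-refl pb)

-- Routing a vertex k times with rotor e₀ sends one chip along each of the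
-- edges next¹ e₀, …, nextᵏ e₀; `passes e₀ k ε` counts how many of those are ε.
module RotorOrbit (G : RibbonDigraph) where
  open RibbonDigraph G

  turn : ℕ → Fin m → Fin m
  turn k e = iter next k e

  turn-tail : ∀ k e → tail (turn k e) ≡ tail e
  turn-tail zero e = refl
  turn-tail (suc k) e = next-tail _ ■ turn-tail k e

  turn-cancel : ∀ k {a b} → turn k a ≡ turn k b → a ≡ b
  turn-cancel k = iter-injective next next-inj k

  passes : Fin m → ℕ → Fin m → ℕ
  passes e₀ zero ε = 0
  passes e₀ (suc k) ε = passes e₀ k ε + ⟦ turn (suc k) e₀ ≟ ε ⟧

  passes-+ : ∀ e₀ a b ε → passes e₀ (a + b) ε ≡ passes e₀ a ε + passes (turn a e₀) b ε
  passes-+ e₀ a zero ε = cong (λ t → passes e₀ t ε) (+-identityʳ a) ■ sym (+-identityʳ _)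
  passes-+ e₀ a (suc b) ε =
    cong (λ t → passes e₀ t ε) (+-suc a b)
    ■ cong₂ _+_ (passes-+ e₀ a b ε) (cong (λ t → ⟦ t ≟ ε ⟧) shift)
    ■ +-assoc (passes e₀ a ε) _ _
    where
      shift : turn (suc (a + b)) e₀ ≡ turn (suc b) (turn a e₀)
      shift = cong (λ t → turn (suc t) e₀) (+-comm a b) ■ iter-+ next (suc b) a e₀

  passes-mono : ∀ e₀ a b ε → passes e₀ a ε ≤ passes e₀ (a + b) ε
  passes-mono e₀ a b ε = subst (passes e₀ a ε ≤_) (sym (passes-+ e₀ a b ε)) (m≤m+n _ _)

  passes-off : ∀ e₀ k ε → tail ε ≢ tail e₀ → passes e₀ k ε ≡ 0
  passes-off e₀ zero ε ne = refl
  passes-off e₀ (suc k) ε ne =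
    cong₂ _+_ (passes-off e₀ k ε ne)
      (⟦⟧-no (turn (suc k) e₀ ≟ ε) (λ eq → ne (sym (cong tail eq) ■ turn-tail (suc k) e₀)))

  passes-total : ∀ e₀ k → sum (passes e₀ k) ≡ k
  passes-total e₀ zero = sum-replicate-zero m
  passes-total e₀ (suc k) =
    ∑-distrib-+ (passes e₀ k) _ ■ cong₂ _+_ (passes-total e₀ k) (sum-δ1 (turn (suc k) e₀)) ■ +-comm k 1

  passes-pos : ∀ e₀ k → 0 < k → 0 < passes e₀ k (turn k e₀)
  passes-pos e₀ (suc j) _ =
    subst (λ t → 0 < passes e₀ j (turn (suc j) e₀) + t) (sym (⟦⟧-yes (turn (suc j) e₀ ≟ _) refl))
      (subst (0 <_) (+-comm 1 _) (s≤s z≤n))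

  passes-within : ∀ e₀ i j → 0 < i → i ≤ j → 0 < passes e₀ j (turn i e₀)
  passes-within e₀ i j 0<i i≤j =
    ≤-trans (passes-pos e₀ i 0<i)
      (subst (passes e₀ i (turn i e₀) ≤_) (cong (λ t → passes e₀ t _) (m+[n∸m]≡n i≤j))
        (passes-mono e₀ i (j ∸ i) _))

  passes-witness : ∀ e₀ j ε → 0 < passes e₀ j ε → Σ ℕ λ i → 0 < i × i ≤ j × turn i e₀ ≡ ε
  passes-witness e₀ zero ε ()
  passes-witness e₀ (suc j) ε h with turn (suc j) e₀ ≟ ε
  ... | yes eq = suc j , s≤s z≤n , ≤-refl , eq
  ... | no _ with passes-witness e₀ j ε (subst (0 <_) (+-identityʳ _) h)
  ... | i , 0<i , i≤j , eq = i , 0<i , m≤n⇒m≤1+n i≤j , eq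

  private
    minimalPeriod : ∀ e₀ → Least (λ i → turn (suc i) e₀ ≡ e₀) (λ i → turn (suc i) e₀ ≟ e₀)
    minimalPeriod e₀ with next-cyc (next e₀) e₀ (next-tail e₀)
    ... | k , eq = least (λ i → turn (suc i) e₀ ≡ e₀) (λ i → turn (suc i) e₀ ≟ e₀) k (iter-suc next k e₀ ■ eq)

  period : Fin m → ℕ
  period e₀ = suc (proj₁ (minimalPeriod e₀))

  turn-period : ∀ e₀ → turn (period e₀) e₀ ≡ e₀
  turn-period e₀ = proj₁ (proj₂ (minimalPeriod e₀))

  period-minimal : ∀ e₀ i → 0 < i → i < period e₀ → turn i e₀ ≢ e₀
  period-minimal e₀ (suc i) _ (s≤s lt) eq = <⇒≱ lt (proj₂ (proj₂ (minimalPeriod e₀)) i eq)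

  passes≤1 : ∀ e₀ j → j ≤ period e₀ → ∀ ε → passes e₀ j ε ≤ 1
  passes≤1 e₀ zero _ ε = z≤n
  passes≤1 e₀ (suc j) sj≤ ε with turn (suc j) e₀ ≟ ε
  ... | no _ = subst (_≤ 1) (sym (+-identityʳ _)) (passes≤1 e₀ j (≤-trans (n≤1+n j) sj≤) ε)
  ... | yes eq with passes e₀ j ε in pj
  ... | zero = s≤s z≤n
  ... | suc _ with passes-witness e₀ j ε (subst (0 <_) (sym pj) (s≤s z≤n))
  ... | i , 0<i , i≤j , eqi = ⊥-elim (period-minimal e₀ d 0<d d<period (sym (turn-cancel i same)))
    where
      d = suc j ∸ i
      same : turn i e₀ ≡ turn i (turn d e₀)
      same = eqi ■ sym eq ■ cong (λ t → turn t e₀) (sym (m+[n∸m]≡n (m≤n⇒m≤1+n i≤j))) ■ iter-+ next i d e₀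
      0<d : 0 < d
      0<d = m<n⇒0<n∸m (s≤s i≤j)
      d<period : d < period e₀
      d<period = ≤-trans (s≤s (∸-monoʳ-≤ (suc j) 0<i)) sj≤

  passes-cover : ∀ e₀ ε → tail ε ≡ tail e₀ → 0 < passes e₀ (period e₀) ε
  passes-cover e₀ ε te with next-cyc e₀ ε (sym te)
  ... | k , eq = reduce (k % period e₀) refl
    where
      instance _ : NonZero (period e₀)
      _ = _
      turn-k : turn k e₀ ≡ turn (k % period e₀) e₀
      turn-k = cong (λ t → turn t e₀) (m≡m%n+[m/n]*n k (period e₀))
               ■ iter-+ next (k % period e₀) _ e₀
               ■ cong (turn (k % period e₀)) (iter-period next (period e₀) e₀ (turn-period e₀) (k / period e₀))
      reduce : ∀ s → k % period e₀ ≡ s → 0 < passes e₀ (period e₀) ε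
      reduce zero s≡ = subst (λ t → 0 < passes e₀ (period e₀) t)
                         (turn-period e₀ ■ sym (turn-k ■ cong (λ t → turn t e₀) s≡) ■ eq)
                         (passes-within e₀ (period e₀) (period e₀) (s≤s z≤n) ≤-refl)
      reduce (suc s) s≡ = subst (λ t → 0 < passes e₀ (period e₀) t)
                            (sym (turn-k ■ cong (λ t → turn t e₀) s≡) ■ eq)
                            (passes-within e₀ (suc s) (period e₀) (s≤s z≤n)
                               (<⇒≤ (subst (_< period e₀) s≡ (m%n<n k (period e₀)))))

  passes-period : ∀ e₀ ε → passes e₀ (period e₀) ε ≡ ⟦ tail ε ≟ tail e₀ ⟧
  passes-period e₀ ε with tail ε ≟ tail e₀
  ... | no ne = passes-off e₀ (period e₀) ε ne
  ... | yes te = ≤-antisym (passes≤1 e₀ (period e₀) ≤-refl ε) (passes-cover e₀ ε te)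

  d⁺ : Fin n → ℕ
  d⁺ v = outdeg graph v

  d⁺-sum : ∀ v → d⁺ v ≡ sum (λ ε → ⟦ tail ε ≟ v ⟧)
  d⁺-sum v = length-filter (λ ε → tail ε ≟ v) id

  period≡d⁺ : ∀ e₀ → period e₀ ≡ d⁺ (tail e₀)
  period≡d⁺ e₀ = sym (d⁺-sum (tail e₀) ■ sum-cong-≗ (λ ε → sym (passes-period e₀ ε)) ■ passes-total e₀ (period e₀))

  d⁺-pos : ∀ e₀ → 0 < d⁺ (tail e₀)
  d⁺-pos e₀ = subst (0 <_) (period≡d⁺ e₀) (s≤s z≤n)

  d⁺-period : ∀ e₀ i → 0 < i → i < d⁺ (tail e₀) → turn i e₀ ≢ e₀
  d⁺-period e₀ i 0<i lt = period-minimal e₀ i 0<i (subst (i <_) (sym (period≡d⁺ e₀)) lt)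

  turn-fixed⇒0 : ∀ e₀ i → i < d⁺ (tail e₀) → turn i e₀ ≡ e₀ → i ≡ 0
  turn-fixed⇒0 e₀ zero _ _ = refl
  turn-fixed⇒0 e₀ (suc i) lt fixed = ⊥-elim (d⁺-period e₀ (suc i) (s≤s z≤n) lt fixed)

  turn-full : ∀ e₀ → turn (d⁺ (tail e₀)) e₀ ≡ e₀
  turn-full e₀ = subst (λ t → turn t e₀ ≡ e₀) (period≡d⁺ e₀) (turn-period e₀)

  turn-d⁺ : ∀ e₀ N → turn (N * d⁺ (tail e₀)) e₀ ≡ e₀
  turn-d⁺ e₀ = iter-period next _ e₀ (turn-full e₀)

  passes≤1-d⁺ : ∀ e₀ j → j ≤ d⁺ (tail e₀) → ∀ ε → passes e₀ j ε ≤ 1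
  passes≤1-d⁺ e₀ j le = passes≤1 e₀ j (subst (j ≤_) (sym (period≡d⁺ e₀)) le)

  passes-full : ∀ e₀ ε → passes e₀ (d⁺ (tail e₀)) ε ≡ ⟦ tail ε ≟ tail e₀ ⟧
  passes-full e₀ ε = subst (λ t → passes e₀ t ε ≡ ⟦ tail ε ≟ tail e₀ ⟧) (period≡d⁺ e₀) (passes-period e₀ ε)

  passes-turns : ∀ e₀ N ε → passes e₀ (N * d⁺ (tail e₀)) ε ≡ N * ⟦ tail ε ≟ tail e₀ ⟧
  passes-turns e₀ zero ε = refl
  passes-turns e₀ (suc N) ε =
    passes-+ e₀ (d⁺ (tail e₀)) (N * d⁺ (tail e₀)) ε
    ■ cong₂ _+_ (passes-full e₀ ε) (cong (λ t → passes t (N * d⁺ (tail e₀)) ε) (turn-full e₀) ■ passes-turns e₀ N ε)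

  passes-start : ∀ e₀ j → j < d⁺ (tail e₀) → passes e₀ j e₀ ≡ 0
  passes-start e₀ j lt with passes e₀ j e₀ in eq
  ... | zero = refl
  ... | suc _ with passes-witness e₀ j e₀ (subst (0 <_) (sym eq) (s≤s z≤n))
  ... | i , 0<i , i≤j , eqi = ⊥-elim (d⁺-period e₀ i 0<i (≤-<-trans i≤j lt) eqi)

  passes-after-turn : ∀ e₀ j ε → d⁺ (tail e₀) ≤ j → tail ε ≡ tail e₀ → 0 < passes e₀ j ε
  passes-after-turn e₀ j ε le te =
    ≤-trans (subst (0 <_) (sym (passes-full e₀ ε ■ ⟦⟧-yes (tail ε ≟ tail e₀) te)) (s≤s z≤n))
      (subst (passes e₀ (d⁺ (tail e₀)) ε ≤_) (cong (λ t → passes e₀ t ε) (m+[n∸m]≡n le))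
        (passes-mono e₀ (d⁺ (tail e₀)) (j ∸ d⁺ (tail e₀)) ε))

  routings<passes : ∀ e₀ k ε → tail ε ≡ tail e₀ → k < suc (passes e₀ k ε) * d⁺ (tail e₀)
  routings<passes e₀ k ε te = ≤-trans k<[q+1]p (*-monoˡ-≤ p (s≤s q≤passes))
    where
      p = d⁺ (tail e₀)
      instance _ : NonZero p
      _ = >-nonZero (d⁺-pos e₀)
      q = k / p
      s = k % p
      k≡ : k ≡ s + q * p
      k≡ = m≡m%n+[m/n]*n k p
      k<[q+1]p : k < suc q * p
      k<[q+1]p = subst (_< suc q * p) (sym k≡) (+-monoˡ-< (q * p) (m%n<n k p))
      e₁ = turn s e₀
      passes-tail : passes e₁ (q * p) ε ≡ q
      passes-tail = subst (λ t → passes e₁ (q * d⁺ t) ε ≡ q * ⟦ tail ε ≟ t ⟧) (turn-tail s e₀) (passes-turns e₁ q ε)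
                    ■ cong (q *_) (⟦⟧-yes (tail ε ≟ tail e₀) te) ■ *-identityʳ q
      q≤passes : q ≤ passes e₀ k ε
      q≤passes = subst (_≤ passes e₀ k ε) passes-tail
                   (subst (passes e₁ (q * p) ε ≤_) (sym (cong (λ t → passes e₀ t ε) k≡ ■ passes-+ e₀ s (q * p) ε))
                     (m≤n+m _ _))

-- Routing is order-independent up to its total effect: routing
-- each vertex u exactly k(u) times turns the rotor at u by k(u) steps and moves
-- the chips recorded by `passes`.  `fire k` is this total effect on a
-- configuration (chips, rotor edges); every routing sequence is a firing.
module Firing (G : RibbonDigraph) where
  open RibbonDigraph G
  open RotorOrbit G

  Config : Set
  Config = (Fin n → ℤ) × (Fin n → Fin m)

  IsRotor : (Fin n → Fin m) → Set
  IsRotor ρ = ∀ u → tail (ρ u) ≡ u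

  config : DRC G → Config
  config c = proj₁ c , Rotor.ρ (proj₂ c)

  sent : (Fin n → ℕ) → (Fin n → Fin m) → Fin m → ℕ
  sent k ρ ε = passes (ρ (tail ε)) (k (tail ε)) ε

  received : (Fin n → ℕ) → (Fin n → Fin m) → Fin n → ℕ
  received k ρ w = sum (λ ε → ⟦ head ε ≟ w ⟧ * sent k ρ ε)

  fire : (Fin n → ℕ) → Config → Config
  fire k (x , ρ) = (λ w → x w -ℤ + k w +ℤ + received k ρ w) , (λ u → turn (k u) (ρ u))

  _≋_ : Config → Config → Set
  (x , ρ) ≋ (y , σ) = (∀ w → x w ≡ y w) × (∀ u → ρ u ≡ σ u)

  ≋-refl : ∀ {c} → c ≋ c
  ≋-refl = (λ _ → refl) , (λ _ → refl)

  ≋-sym : ∀ {c d} → c ≋ d → d ≋ c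
  ≋-sym (p , q) = (λ w → sym (p w)) , (λ u → sym (q u))

  ≋-trans : ∀ {c d e} → c ≋ d → d ≋ e → c ≋ e
  ≋-trans (p , q) (p′ , q′) = (λ w → p w ■ p′ w) , (λ u → q u ■ q′ u)

  fire-isRotor : ∀ k x ρ → IsRotor ρ → IsRotor (proj₂ (fire k (x , ρ)))
  fire-isRotor k x ρ t u = turn-tail (k u) (ρ u) ■ t u

  fire-cong : ∀ {k k′ : Fin n → ℕ} {c c′} → (∀ u → k u ≡ k′ u) → c ≋ c′ → fire k c ≋ fire k′ c′
  fire-cong {k} {k′} {x , ρ} {x′ , ρ′} kk (px , pρ) =
    (λ w → cong₃ (λ a b s → a -ℤ + b +ℤ + s) (px w) (kk w) (sum-cong-≗ (λ ε → cong (⟦ head ε ≟ w ⟧ *_) (sent≡ ε)))) ,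
    (λ u → cong₂ turn (kk u) (pρ u))
    where
      cong₃ : ∀ {A B C D : Set} (f : A → B → C → D) {a a′ b b′ c c′} → a ≡ a′ → b ≡ b′ → c ≡ c′ → f a b c ≡ f a′ b′ c′
      cong₃ f refl refl refl = refl
      sent≡ : ∀ ε → sent k ρ ε ≡ sent k′ ρ′ ε
      sent≡ ε = cong₂ (λ a b → passes a b ε) (pρ (tail ε)) (kk (tail ε))

  fire-zero : ∀ c → fire (λ _ → 0) c ≋ c
  fire-zero (x , ρ) =
    (λ w → cong (λ a → x w -ℤ 0ℤ +ℤ + a) (sum-cong-≗ (λ ε → *-zeroʳ ⟦ head ε ≟ w ⟧) ■ sum-replicate-zero m)
           ■ neutral (x w)) ,
    (λ _ → refl)
    where
      neutral : ∀ a → a -ℤ 0ℤ +ℤ 0ℤ ≡ a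
      neutral = solveℤ

  fire-+ : ∀ a b c → fire a (fire b c) ≋ fire (λ u → b u + a u) c
  fire-+ a b (x , ρ) =
    (λ w → regroup (x w) (+ b w) (+ a w) (+ received b ρ w) (+ received a ρb w)
           ■ cong₂ (λ s t → x w -ℤ s +ℤ t) (sym (ℤP.pos-+ (b w) (a w)))
                   (sym (ℤP.pos-+ (received b ρ w) (received a ρb w)) ■ cong +_ (sym (received-+ w)))) ,
    (λ u → sym (iter-+ next (a u) (b u) (ρ u)) ■ cong (λ t → turn t (ρ u)) (+-comm (a u) (b u)))
    where
      ρb = λ u → turn (b u) (ρ u)
      regroup : ∀ x b a i j → x -ℤ b +ℤ i -ℤ a +ℤ j ≡ x -ℤ (b +ℤ a) +ℤ (i +ℤ j)
      regroup = solveℤ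
      received-+ : ∀ w → received (λ u → b u + a u) ρ w ≡ received b ρ w + received a ρb w
      received-+ w =
        sum-cong-≗ (λ ε → cong (⟦ head ε ≟ w ⟧ *_) (passes-+ (ρ (tail ε)) (b (tail ε)) (a (tail ε)) ε)
                          ■ *-distribˡ-+ ⟦ head ε ≟ w ⟧ (sent b ρ ε) (sent a ρb ε))
        ■ ∑-distrib-+ (λ ε → ⟦ head ε ≟ w ⟧ * sent b ρ ε) (λ ε → ⟦ head ε ≟ w ⟧ * sent a ρb ε)

  δ : Fin n → Fin n → ℕ
  δ v u = ⟦ u ≟ v ⟧

  ind≡⟦⟧ : ∀ v w → ind G v w ≡ + ⟦ w ≟ v ⟧
  ind≡⟦⟧ v w with w ≟ v
  ... | yes _ = refl
  ... | no _ = refl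

  route≋fire : ∀ v (c : DRC G) → config (route G v c) ≋ fire (δ v) (config c)
  route≋fire v (x , rot) = chips , rotors
    where
      open Rotor rot
      rotors : ∀ u → Rotor.ρ (proj₂ (route G v (x , rot))) u ≡ turn (δ v u) (ρ u)
      rotors u with u ≟ v
      ... | yes refl = refl
      ... | no _ = refl
      sent-δ : ∀ ε → sent (δ v) ρ ε ≡ ⟦ next (ρ v) ≟ ε ⟧
      sent-δ ε with tail ε ≟ v
      ... | yes te = cong (λ t → ⟦ next (ρ t) ≟ ε ⟧) te
      ... | no ne = sym (⟦⟧-no (next (ρ v) ≟ ε) (λ eq → ne (sym (cong tail eq) ■ next-tail (ρ v) ■ ρ-tail v)))
      received-δ : ∀ w → received (δ v) ρ w ≡ ⟦ head (next (ρ v)) ≟ w ⟧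
      received-δ w = sum-cong-≗ (λ ε → cong (⟦ head ε ≟ w ⟧ *_) (sent-δ ε) ■ *-comm ⟦ head ε ≟ w ⟧ _)
                     ■ sum-δ (next (ρ v)) (λ ε → ⟦ head ε ≟ w ⟧)
      chips : ∀ w → proj₁ (route G v (x , rot)) w ≡ x w -ℤ + ⟦ w ≟ v ⟧ +ℤ + received (δ v) ρ w
      chips w = cong₂ (λ s t → x w -ℤ s +ℤ t) (ind≡⟦⟧ v w)
                  (ind≡⟦⟧ (head (next (ρ v))) w ■ cong +_ (⟦≟⟧-sym w _ ■ sym (received-δ w)))

  routes⇒fire : ∀ {c d} → Star (RoutesTo G) c d → Σ (Fin n → ℕ) λ k → config d ≋ fire k (config c)
  routes⇒fire {c} done = (λ _ → 0) , ≋-sym (fire-zero (config c))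
  routes⇒fire {c} ((v , refl) ◅ rest) with routes⇒fire rest
  ... | k , d≋ = (λ u → δ v u + k u) ,
      ≋-trans d≋ (≋-trans (fire-cong (λ _ → refl) (route≋fire v c)) (fire-+ k (δ v) (config c)))

  fire-turns : ∀ (M : Fin n → ℕ) x ρ → IsRotor ρ →
    fire (λ u → M u * d⁺ u) (x , ρ) ≋
      ((λ w → x w -ℤ + (M w * d⁺ w) +ℤ + sum (λ ε → ⟦ head ε ≟ w ⟧ * M (tail ε))) , ρ)
  fire-turns M x ρ t =
    (λ w → cong (λ s → x w -ℤ + (M w * d⁺ w) +ℤ + s) (sum-cong-≗ (λ ε → cong (⟦ head ε ≟ w ⟧ *_) (sent-M ε)))) ,
    (λ u → subst (λ z → turn (M u * d⁺ z) (ρ u) ≡ ρ u) (t u) (turn-d⁺ (ρ u) (M u)))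
    where
      sent-M : ∀ ε → sent (λ u → M u * d⁺ u) ρ ε ≡ M (tail ε)
      sent-M ε = subst (λ z → passes (ρ (tail ε)) (M (tail ε) * d⁺ z) ε ≡ M (tail ε) * ⟦ tail ε ≟ tail (ρ (tail ε)) ⟧)
                   (t (tail ε)) (passes-turns (ρ (tail ε)) (M (tail ε)) ε)
                 ■ cong (M (tail ε) *_) (⟦⟧-yes (tail ε ≟ _) (sym (t (tail ε)))) ■ *-identityʳ _

-- On an Eulerian digraph, firing every vertex the same number of full turns is
-- the identity; hence firing vectors may be reduced modulo full turns, and
-- linear equivalence becomes the symmetric relation "related by a firing".
module EulerianFiring (G : RibbonDigraph) (eul : Eulerian (RibbonDigraph.graph G)) where
  open RibbonDigraph G
  open RotorOrbit G
  open Firing G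

  d⁻-sum : ∀ w → indeg graph w ≡ sum (λ ε → ⟦ head ε ≟ w ⟧)
  d⁻-sum w = length-filter (λ ε → head ε ≟ w) id

  fire-all-turns : ∀ N x ρ → IsRotor ρ → fire (λ u → N * d⁺ u) (x , ρ) ≋ (x , ρ)
  fire-all-turns N x ρ t =
    ≋-trans (fire-turns (λ _ → N) x ρ t)
      ((λ w → cong (λ s → x w -ℤ + (N * d⁺ w) +ℤ s) (cong +_ (in≡out w)) ■ cancel (x w) (+ (N * d⁺ w))) ,
       (λ _ → refl))
    where
      cancel : ∀ x a → x -ℤ a +ℤ a ≡ x
      cancel = solveℤ
      in≡out : ∀ w → sum (λ ε → ⟦ head ε ≟ w ⟧ * N) ≡ N * d⁺ w
      in≡out w = sum-cong-≗ (λ ε → *-comm ⟦ head ε ≟ w ⟧ N) ■ sym (*-distribˡ-sum N (λ ε → ⟦ head ε ≟ w ⟧))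
                 ■ cong (N *_) (sym (d⁻-sum w) ■ eul w)

  fire-reduce : ∀ N k x ρ → IsRotor ρ → fire (λ u → k u + N * d⁺ u) (x , ρ) ≋ fire k (x , ρ)
  fire-reduce N k x ρ t = ≋-trans (≋-sym (fire-+ (λ u → N * d⁺ u) k (x , ρ))) (fire-all-turns N _ _ (fire-isRotor k x ρ t))

  Fires : Config → Config → Set
  Fires c d = Σ (Fin n → ℕ) λ k → d ≋ fire k c

  Fires-trans : ∀ {c d e} → Fires c d → Fires d e → Fires c e
  Fires-trans {c} (a , d≋) (b , e≋) =
    (λ u → a u + b u) , ≋-trans e≋ (≋-trans (fire-cong (λ _ → refl) d≋) (fire-+ b a c))

  -- Undo a firing k by completing every vertex to N = Σ k full turns.
  Fires-sym : ∀ {x ρ d} → IsRotor ρ → Fires (x , ρ) d → Fires d (x , ρ)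
  Fires-sym {x} {ρ} t (k , d≋) =
    k′ , ≋-sym (≋-trans (fire-cong (λ _ → refl) d≋) (≋-trans (fire-+ k′ k (x , ρ))
           (≋-trans (fire-cong {c = x , ρ} (λ u → m+[n∸m]≡n (k≤ u) ■ sym (+-identityˡ (N * d⁺ u))) ≋-refl)
             (≋-trans (fire-reduce N (λ _ → 0) x ρ t) (fire-zero (x , ρ))))))
    where
      N = sum k
      k′ = λ u → N * d⁺ u ∸ k u
      k≤ : ∀ u → k u ≤ N * d⁺ u
      k≤ u = ≤-trans (term≤sum k u) (m≤m*n N (d⁺ u) ⦃ >-nonZero (subst (λ z → 0 < d⁺ z) (t u) (d⁺-pos (ρ u))) ⦄)

  linEquiv⇒fires : ∀ {c d} → LinEquiv G c d → Fires (config c) (config d)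
  linEquiv⇒fires (inj₁ s) = routes⇒fire s
  linEquiv⇒fires {c} {d} (inj₂ s) = Fires-sym (Rotor.ρ-tail (proj₂ d)) (routes⇒fire s)

module UndirectedReach (D : Digraph) {S : Pred (Fin (Digraph.m D)) 0ℓ} where
  open Digraph D

  UReach-trans : ∀ {a b c} → UReach D S a b → UReach D S b c → UReach D S a c
  UReach-trans p here = p
  UReach-trans p (fwd e s q eq) = fwd e s (UReach-trans p q) eq
  UReach-trans p (bwd e s q eq) = bwd e s (UReach-trans p q) eq

  UReach-sym : ∀ {a b} → UReach D S a b → UReach D S b a
  UReach-sym here = here
  UReach-sym (fwd e s q refl) = UReach-trans (bwd e s here refl) (UReach-sym q)
  UReach-sym (bwd e s q refl) = UReach-trans (fwd e s here refl) (UReach-sym q)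

module RotorWalk (G : RibbonDigraph) where
  open RibbonDigraph G

  follow : (Fin n → Fin m) → Fin n → Fin n
  follow ρ v = head (ρ v)

module RootedRotors (G : RibbonDigraph) (r : Fin (RibbonDigraph.n G)) where
  open RibbonDigraph G
  open UndirectedReach graph
  open RotorWalk G public

  ReachesRoot : (Fin n → Fin m) → Set
  ReachesRoot ρ = ∀ v → Σ ℕ λ j → iter (follow ρ) j v ≡ r

  good⇒reachesRoot : ∀ e (c : DRC G) → Good G r e c → ReachesRoot (Rotor.ρ (proj₂ c))
  good⇒reachesRoot e (x , rot) (_ , _ , _ , _ , connected) v = from-root (connected r v)
    where
      open Rotor rot
      from-root : ∀ {v} → UReach graph (rotorEdges G rot r) r v → Σ ℕ λ j → iter (follow ρ) j v ≡ r
      from-root here = 0 , refl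
      from-root (fwd ε (u , u≢r , refl) p refl) with from-root p
      ... | zero , u≡r = ⊥-elim (u≢r (sym (ρ-tail u) ■ u≡r))
      ... | suc j , hit = j , subst (λ z → iter (follow ρ) j (follow ρ z) ≡ r) (ρ-tail u)
                                (sym (iter-suc (follow ρ) j (tail (ρ u))) ■ hit)
      from-root (bwd ε (u , u≢r , refl) p refl) with from-root p
      ... | j , hit = suc j , iter-suc (follow ρ) j (tail (ρ u))
                               ■ cong (λ z → iter (follow ρ) j (follow ρ z)) (ρ-tail u) ■ hit

  module _ (rot : Rotor G) where
    open Rotor rot
    private
      S = rotorEdges G rot r
      S? = rotorEdges? G rot r

    countE≡sum : ∀ {P : Pred (Fin m) 0ℓ} P? → countE graph {P} P? ≡ sum (λ ε → ⟦ P? ε ⟧)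
    countE≡sum P? = length-filter P? id

    rotor-outdeg-one : ∀ v → v ≢ r → countE graph (λ ε → S? ε ×-dec (tail ε ≟ v)) ≡ 1
    rotor-outdeg-one v v≢r =
      countE≡sum (λ ε → S? ε ×-dec (tail ε ≟ v))
      ■ sum-cong-≗ (λ ε → ⟦⟧-⇔ (S? ε ×-dec (tail ε ≟ v)) (ρ v ≟ ε) (is-ρv ε) (chosen ε))
      ■ sum-δ1 (ρ v)
      where
        is-ρv : ∀ ε → S ε × tail ε ≡ v → ρ v ≡ ε
        is-ρv ε ((u , _ , ρu≡ε) , te) = subst (λ z → ρ z ≡ ε) (sym (ρ-tail u) ■ cong tail ρu≡ε ■ te) ρu≡ε
        chosen : ∀ ε → ρ v ≡ ε → S ε × tail ε ≡ v
        chosen ε ρv≡ε = (v , v≢r , ρv≡ε) , (sym (cong tail ρv≡ε) ■ ρ-tail v)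

    rotor-edge-count : countE graph S? ≡ n ∸ 1
    rotor-edge-count =
      countE≡sum S?
      ■ sum-cong-≗ chosen-edge
      ■ sum-fibres tail (λ u → ⟦ ¬? (u ≟ r) ⟧) (λ ε → ⟦ ρ (tail ε) ≟ ε ⟧)
      ■ sum-cong-≗ (λ u → cong (⟦ ¬? (u ≟ r) ⟧ *_) (one-per-vertex u) ■ *-identityʳ _)
      ■ sym (m+n∸n≡m _ 1) ■ cong (_∸ 1) non-roots
      where
        chosen-edge : ∀ ε → ⟦ S? ε ⟧ ≡ ⟦ ¬? (tail ε ≟ r) ⟧ * ⟦ ρ (tail ε) ≟ ε ⟧
        chosen-edge ε =
          ⟦⟧-⇔ (S? ε) (¬? (tail ε ≟ r) ×-dec (ρ (tail ε) ≟ ε)) unpack pack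
          ■ ⟦⟧-× (¬? (tail ε ≟ r) ×-dec (ρ (tail ε) ≟ ε)) (¬? (tail ε ≟ r)) (ρ (tail ε) ≟ ε)
          where
            unpack : S ε → (tail ε ≢ r) × ρ (tail ε) ≡ ε
            unpack (u , u≢r , refl) = (λ h → u≢r (sym (ρ-tail u) ■ h)) , cong ρ (ρ-tail u)
            pack : (tail ε ≢ r) × ρ (tail ε) ≡ ε → S ε
            pack (t≢r , eq) = tail ε , t≢r , eq
        one-per-vertex : ∀ u → sum (λ ε → ⟦ tail ε ≟ u ⟧ * ⟦ ρ (tail ε) ≟ ε ⟧) ≡ 1
        one-per-vertex u = sum-cong-≗ at-u ■ sum-δ1 (ρ u)
          where
            at-u : ∀ ε → ⟦ tail ε ≟ u ⟧ * ⟦ ρ (tail ε) ≟ ε ⟧ ≡ ⟦ ρ u ≟ ε ⟧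
            at-u ε with tail ε ≟ u
            ... | yes te = +-identityʳ _ ■ cong (λ z → ⟦ ρ z ≟ ε ⟧) te
            ... | no ne = sym (⟦⟧-no (ρ u ≟ ε) (λ eq → ne (sym (cong tail eq) ■ ρ-tail u)))
        non-roots : sum (λ u → ⟦ ¬? (u ≟ r) ⟧) + 1 ≡ n
        non-roots =
          cong (λ z → sum (λ u → ⟦ ¬? (u ≟ r) ⟧) + z) (sym (sum-cong-≗ (λ u → ⟦≟⟧-sym u r) ■ sum-δ1 r))
          ■ sym (∑-distrib-+ (λ u → ⟦ ¬? (u ≟ r) ⟧) (λ u → ⟦ u ≟ r ⟧))
          ■ sum-cong-≗ (λ u → ⟦⟧-¬ (u ≟ r) (¬? (u ≟ r))) ■ sum-ones

    rotor-connected : ReachesRoot ρ → ∀ u v → UReach graph S u v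
    rotor-connected reach u v = UReach-trans (to-root (proj₁ (reach u)) u (proj₂ (reach u)))
                                  (UReach-sym (to-root (proj₁ (reach v)) v (proj₂ (reach v))))
      where
        to-root : ∀ j v → iter (follow ρ) j v ≡ r → UReach graph S v r
        to-root zero v refl = here
        to-root (suc j) v hit with v ≟ r
        ... | yes refl = here
        ... | no v≢r = UReach-trans (fwd (ρ v) (v , v≢r , refl) (subst (UReach graph S v) (sym (ρ-tail v)) here) refl)
                         (to-root j (follow ρ v) (sym (iter-suc (follow ρ) j v) ■ hit))

    reachesRoot⇒arborescence : ReachesRoot ρ → IsSpanningInArborescence graph r S?
    reachesRoot⇒arborescence reach = rotor-outdeg-one , rotor-edge-count , rotor-connected reach

bracket-ineq : ∀ a b p → a ≤ 1 → b ≤ 1 → (a ≡ 1 → b ≡ 0 → 1 ≤ p) → (a ≡ 0 → b ≡ 1 → p ≤ 1) →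
               b * p + a ≤ a * p + b
bracket-ineq zero zero p _ _ _ _ = ≤-refl
bracket-ineq zero (suc zero) p _ _ _ h = subst (_≤ 1) (sym (+-identityʳ (p + 0) ■ +-identityʳ p)) (h refl refl)
bracket-ineq (suc zero) zero p _ _ h _ = subst (1 ≤_) (sym (+-identityʳ (p + 0) ■ +-identityʳ p)) (h refl refl)
bracket-ineq (suc zero) (suc zero) p _ _ _ _ = ≤-refl
bracket-ineq a (suc (suc b)) p _ (s≤s ()) _ _
bracket-ineq (suc (suc a)) b p (s≤s ()) _ _ _

module Uniqueness (G : RibbonDigraph) (eul : Eulerian (RibbonDigraph.graph G)) (r : Fin (RibbonDigraph.n G)) where
  open RibbonDigraph G
  open RotorOrbit G
  open Firing G
  open EulerianFiring G eul
  open RootedRotors G r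

  Conserving : (Fin n → ℕ) → (Fin n → Fin m) → Set
  Conserving k ρ = ∀ w → k w ≡ received k ρ w

  sent-from : ∀ k ρ ε u → tail ε ≡ u → sent k ρ ε ≡ passes (ρ u) (k u) ε
  sent-from k ρ ε u refl = refl

  sent-out : ∀ k ρ → IsRotor ρ → ∀ w → sum (λ ε → ⟦ tail ε ≟ w ⟧ * sent k ρ ε) ≡ k w
  sent-out k ρ t w = sum-cong-≗ out-edge ■ passes-total (ρ w) (k w)
    where
      out-edge : ∀ ε → ⟦ tail ε ≟ w ⟧ * sent k ρ ε ≡ passes (ρ w) (k w) ε
      out-edge ε with tail ε ≟ w
      ... | yes te = +-identityʳ _ ■ sent-from k ρ ε w te
      ... | no ne = sym (passes-off (ρ w) (k w) ε (λ eq → ne (eq ■ t w)))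

  flow-balance : ∀ k ρ → IsRotor ρ → Conserving k ρ → ∀ (F : Fin n → ℕ) →
                 sum (λ ε → F (head ε) * sent k ρ ε) ≡ sum (λ ε → F (tail ε) * sent k ρ ε)
  flow-balance k ρ t cons F =
    sum-fibres head F (sent k ρ)
    ■ sum-cong-≗ (λ w → cong (F w *_) (sym (cons w) ■ sym (sent-out k ρ t w)))
    ■ sym (sum-fibres tail F (sent k ρ))

  degree-balance : ∀ (F : Fin n → ℕ) → sum (λ ε → F (head ε)) ≡ sum (λ ε → F (tail ε))
  degree-balance F = by-fibres head ■ sum-cong-≗ (λ w → cong (F w *_) (sym (d⁻-sum w) ■ eul w ■ d⁺-sum w))
                     ■ sym (by-fibres tail)
    where
      by-fibres : ∀ (h : Fin m → Fin n) → sum (λ ε → F (h ε)) ≡ sum (λ w → F w * sum (λ ε → ⟦ h ε ≟ w ⟧))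
      by-fibres h = sum-cong-≗ (λ ε → sym (*-identityʳ (F (h ε)))) ■ sum-fibres h F (λ _ → 1)
                    ■ sum-cong-≗ (λ w → cong (F w *_) (sum-cong-≗ (λ ε → *-identityʳ ⟦ h ε ≟ w ⟧)))

  -- Otherwise some q with
  -- k q < d⁺ q has its rotor edge leaving Q = {u ∣ k u < d⁺ u}, and comparing
  -- the flows into and out of Q edge by edge yields a strict inequality between
  -- two equal sums.
  root-incomplete : ∀ k ρ → IsRotor ρ → ReachesRoot ρ → Conserving k ρ →
                    (Σ (Fin n) λ u₀ → k u₀ < d⁺ u₀) → k r < d⁺ r
  root-incomplete k ρ t reach cons (u₀ , u₀∈Q) with k r <? d⁺ r
  ... | yes r∈Q = r∈Q
  ... | no r∉Q = ⊥-elim (<-irrefl refl (subst (_< sum L) (sym balance) (sum-mono-< pointwise (ρ q) strict)))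
    where
      Q? = λ u → k u <? d⁺ u
      [Q] : Fin n → ℕ
      [Q] u = ⟦ Q? u ⟧
      exit = orbit-exit Q? (follow ρ) (proj₁ (reach u₀)) u₀ u₀∈Q
               (λ h → r∉Q (subst (λ u → k u < d⁺ u) (proj₂ (reach u₀)) h))
      q = proj₁ exit
      q∈Q = proj₁ (proj₂ exit)
      next∉Q = proj₂ (proj₂ exit)
      L R : Fin m → ℕ
      L ε = [Q] (head ε) * sent k ρ ε + [Q] (tail ε)
      R ε = [Q] (tail ε) * sent k ρ ε + [Q] (head ε)
      balance : sum L ≡ sum R
      balance = ∑-distrib-+ (λ ε → [Q] (head ε) * sent k ρ ε) (λ ε → [Q] (tail ε))
                ■ cong₂ _+_ (flow-balance k ρ t cons [Q]) (sym (degree-balance [Q]))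
                ■ sym (∑-distrib-+ (λ ε → [Q] (tail ε) * sent k ρ ε) (λ ε → [Q] (head ε)))
      -- a vertex outside Q has made a full turn, one inside Q at most one turn
      full-turn : ∀ ε → [Q] (tail ε) ≡ 0 → 1 ≤ sent k ρ ε
      full-turn ε out = subst (0 <_) (sym (sent-from k ρ ε (tail ε) refl))
        (passes-after-turn (ρ (tail ε)) (k (tail ε)) ε
          (subst (λ z → d⁺ z ≤ k (tail ε)) (sym (t (tail ε))) (≮⇒≥ (⟦⟧≡0⇒ (Q? (tail ε)) out)))
          (sym (t (tail ε))))
      part-turn : ∀ ε → [Q] (tail ε) ≡ 1 → sent k ρ ε ≤ 1
      part-turn ε inn = subst (_≤ 1) (sym (sent-from k ρ ε (tail ε) refl))
        (passes≤1-d⁺ (ρ (tail ε)) (k (tail ε))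
          (subst (λ z → k (tail ε) ≤ d⁺ z) (sym (t (tail ε))) (<⇒≤ (⟦⟧≡1⇒ (Q? (tail ε)) inn))) ε)
      pointwise : ∀ ε → R ε ≤ L ε
      pointwise ε = bracket-ineq ([Q] (head ε)) ([Q] (tail ε)) (sent k ρ ε) (⟦⟧≤1 (Q? (head ε))) (⟦⟧≤1 (Q? (tail ε)))
                      (λ _ out → full-turn ε out) (λ _ inn → part-turn ε inn)
      -- along the exit edge ρ q no chip has been sent, as q has not completed a turn
      unused : sent k ρ (ρ q) ≡ 0
      unused = sent-from k ρ (ρ q) q (t q) ■ passes-start (ρ q) (k q) (subst (λ z → k q < d⁺ z) (sym (t q)) q∈Q)
      strict : R (ρ q) < L (ρ q)
      strict rewrite ⟦⟧-no (Q? (head (ρ q))) next∉Q | ⟦⟧-yes (Q? (tail (ρ q))) (subst (λ u → k u < d⁺ u) (sym (t q)) q∈Q)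
                   | unused = s≤s z≤n

  -- If a conserving firing does not fire the root, it fires nothing: a vertex that
  -- fires sends its last chip along its final rotor edge, so firing vertices are
  -- closed under following the final rotors, which lead to the root.
  root-idle⇒idle : ∀ k ρ → IsRotor ρ → Conserving k ρ → ReachesRoot (λ u → turn (k u) (ρ u)) →
                   k r ≡ 0 → ∀ u → k u ≡ 0
  root-idle⇒idle k ρ t cons reach′ kr≡0 u with k u in ku
  ... | zero = refl
  ... | suc _ with reach′ u
  ... | j , hits-r = ⊥-elim (<⇒≢ (subst (λ v → 0 < k v) hits-r (firing-along j)) (sym kr≡0))
    where
      ρ′ = λ u → turn (k u) (ρ u)
      closed : ∀ w → 0 < k w → 0 < k (follow ρ′ w)
      closed w kw>0 = subst (0 <_) (sym (cons (follow ρ′ w))) (≤-trans last-chip (term≤sum _ (ρ′ w)))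
        where
          last-chip : 0 < ⟦ head (ρ′ w) ≟ follow ρ′ w ⟧ * sent k ρ (ρ′ w)
          last-chip rewrite ⟦⟧-yes (head (ρ′ w) ≟ follow ρ′ w) refl | +-identityʳ (sent k ρ (ρ′ w))
                          | sent-from k ρ (ρ′ w) w (turn-tail (k w) (ρ w) ■ t w) = passes-pos (ρ w) (k w) kw>0
      firing-along : ∀ i → 0 < k (iter (follow ρ′) i u)
      firing-along zero = subst (0 <_) (sym ku) (s≤s z≤n)
      firing-along (suc i) = closed _ (firing-along i)

  chips-fixed⇒conserving : ∀ {x y ρ ρ′} k → (∀ w → x w ≡ y w) → (y , ρ′) ≋ fire k (x , ρ) → Conserving k ρ
  chips-fixed⇒conserving {x} {y} {ρ} k x≡y (chips , _) w =
    ℤP.+-injective (sym (cancel (x w) (+ k w) (+ received k ρ w) (x≡y w ■ chips w)))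
    where
      cancel : ∀ a b c → a ≡ a -ℤ b +ℤ c → c ≡ b
      cancel a b c h = regroup a b c ■ cong (λ z → z -ℤ a +ℤ b) (sym h) ■ collapse a b
        where
          regroup : ∀ a b c → c ≡ (a -ℤ b +ℤ c) -ℤ a +ℤ b
          regroup = solveℤ
          collapse : ∀ a b → a -ℤ a +ℤ b ≡ b
          collapse = solveℤ

  conserving⇒idle : ∀ k ρ → IsRotor ρ → ReachesRoot ρ → ReachesRoot (λ u → turn (k u) (ρ u)) →
                    turn (k r) (ρ r) ≡ ρ r → Conserving k ρ → (Σ (Fin n) λ u₀ → k u₀ < d⁺ u₀) →
                    ∀ u → k u ≡ 0
  conserving⇒idle k ρ t reach reach′ root-fixed cons incomplete =
    root-idle⇒idle k ρ t cons reach′ (turn-fixed⇒0 (ρ r) (k r) kr<d⁺ root-fixed)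
    where
      kr<d⁺ : k r < d⁺ (tail (ρ r))
      kr<d⁺ = subst (λ z → k r < d⁺ z) (sym (t r)) (root-incomplete k ρ t reach cons incomplete)

  -- Full turns at
  -- every vertex are stripped off (they act trivially) until some vertex
  -- fires less than a full turn, and then the firing is trivial.
  rotors-agree : ∀ {x y} ρ ρ′ → IsRotor ρ → ReachesRoot ρ → ReachesRoot ρ′ → ρ r ≡ ρ′ r →
                 (∀ w → x w ≡ y w) → Fires (x , ρ) (y , ρ′) → ∀ u → ρ u ≡ ρ′ u
  rotors-agree {x} {y} ρ ρ′ t reach reach′ same-root x≡y (k₀ , h₀) = go k₀ (<-wellFounded (sum k₀)) h₀
    where
      go : ∀ k → Acc _<_ (sum k) → (y , ρ′) ≋ fire k (x , ρ) → ∀ u → ρ u ≡ ρ′ u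
      go k (acc smaller) h with all? (λ u → d⁺ u ≤? k u)
      ... | yes all-full = go k′ (smaller fewer) (≋-trans h (≋-trans (fire-cong {c = x , ρ} one-turn-more ≋-refl) (fire-reduce 1 k′ x ρ t)))
        where
          k′ = λ u → k u ∸ d⁺ u
          one-turn-more : ∀ u → k u ≡ k′ u + 1 * d⁺ u
          one-turn-more u = sym (m∸n+n≡m (all-full u)) ■ cong (λ z → k′ u + z) (sym (*-identityˡ (d⁺ u)))
          fewer : sum k′ < sum k
          fewer = sum-mono-< (λ u → m∸n≤m (k u) (d⁺ u)) r
                    (∸-monoʳ-< {o = 0} (subst (λ z → 0 < d⁺ z) (t r) (d⁺-pos (ρ r))) (all-full r))
      ... | no ¬all-full = λ u → sym (proj₂ h u ■ cong (λ z → turn z (ρ u)) (idle u))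
        where
          incomplete = ¬∀⟶∃¬ n (λ u → d⁺ u ≤ k u) (λ u → d⁺ u ≤? k u) ¬all-full
          reach-final : ReachesRoot (λ u → turn (k u) (ρ u))
          reach-final v = proj₁ (reach′ v) , (sym (iter-cong (λ a → cong head (proj₂ h a)) (proj₁ (reach′ v)) v) ■ proj₂ (reach′ v))
          idle = conserving⇒idle k ρ t reach reach-final (sym (proj₂ h r) ■ sym same-root)
                   (chips-fixed⇒conserving k x≡y h) (proj₁ incomplete , ≰⇒> (proj₂ incomplete))

  uniqueness : ∀ e c d d′ → Good G r e d → LinEquiv G c d → Good G r e d′ → LinEquiv G c d′ → _≈DRC_ G d d′
  uniqueness e c d d′ gd c~d gd′ c~d′ =
    (λ v → proj₁ gd v ■ sym (proj₁ gd′ v)) ,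
    rotors-agree ρ ρ′ (Rotor.ρ-tail (proj₂ d)) (good⇒reachesRoot e d gd) (good⇒reachesRoot e d′ gd′)
      (proj₁ (proj₂ gd) ■ sym (proj₁ (proj₂ gd′))) (λ v → proj₁ gd v ■ sym (proj₁ gd′ v))
      (Fires-trans {config d} {config c} {config d′} (Fires-sym (Rotor.ρ-tail (proj₂ c)) (linEquiv⇒fires c~d)) (linEquiv⇒fires c~d′))
    where
      ρ = Rotor.ρ (proj₂ d)
      ρ′ = Rotor.ρ (proj₂ d′)

module Degree (G : RibbonDigraph) where
  open RibbonDigraph G

  route-preserves-deg : ∀ v (c : DRC G) → sumℤ (proj₁ (route G v c)) ≡ sumℤ (proj₁ c)
  route-preserves-deg v (x , rot) =
    sumℤ-+ (λ w → x w -ℤ ind G v w) (ind G v′)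
    ■ cong₂ _+ℤ_ (sumℤ-- x (ind G v)) (sumℤ-at v′ (λ _ → 1ℤ))
    ■ cong (λ z → sumℤ x -ℤ z +ℤ 1ℤ) (sumℤ-at v (λ _ → 1ℤ))
    ■ cancel (sumℤ x)
    where
      v′ = head (next (Rotor.ρ rot v))
      cancel : ∀ a → a -ℤ 1ℤ +ℤ 1ℤ ≡ a
      cancel = solveℤ

  routes-preserve-deg : ∀ {c d} → Star (RoutesTo G) c d → sumℤ (proj₁ d) ≡ sumℤ (proj₁ c)
  routes-preserve-deg done = refl
  routes-preserve-deg {c} ((v , refl) ◅ rest) = routes-preserve-deg rest ■ route-preserves-deg v c

  module OffRoot (r : Fin n) where
    offRoot : (Fin n → ℤ) → ℤ
    offRoot f = sumℤ (λ w → if does (w ≟ r) then 0ℤ else f w)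

    sum≡root+offRoot : ∀ (f : Fin n → ℤ) → sumℤ f ≡ f r +ℤ offRoot f
    sum≡root+offRoot f =
      sumℤ-cong split ■ sumℤ-+ (λ w → if does (w ≟ r) then f w else 0ℤ) (λ w → if does (w ≟ r) then 0ℤ else f w)
      ■ cong (_+ℤ offRoot f) (sumℤ-at r f)
      where
        split : ∀ w → f w ≡ (if does (w ≟ r) then f w else 0ℤ) +ℤ (if does (w ≟ r) then 0ℤ else f w)
        split w with does (w ≟ r)
        ... | true = sym (ℤP.+-identityʳ (f w))
        ... | false = sym (ℤP.+-identityˡ (f w))

    private
      off-nonneg : ∀ (f : Fin n → ℤ) → (∀ w → w ≢ r → 0ℤ ≤ℤ f w) → ∀ w → 0ℤ ≤ℤ (if does (w ≟ r) then 0ℤ else f w)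
      off-nonneg f h w with w ≟ r
      ... | yes _ = ℤP.≤-refl
      ... | no w≢r = h w w≢r

    offRoot-nonneg : ∀ (f : Fin n → ℤ) → (∀ w → w ≢ r → 0ℤ ≤ℤ f w) → 0ℤ ≤ℤ offRoot f
    offRoot-nonneg f h = sumℤ-nonneg _ (off-nonneg f h)

    term≤offRoot : ∀ (f : Fin n → ℤ) → (∀ w → w ≢ r → 0ℤ ≤ℤ f w) → ∀ w → w ≢ r → f w ≤ℤ offRoot f
    term≤offRoot f h w w≢r = subst (_≤ℤ offRoot f) (if-no (w ≟ r) w≢r) (term≤sumℤ _ (off-nonneg f h) w)

    offRoot-zero : ∀ (f : Fin n → ℤ) → (∀ w → w ≢ r → f w ≡ 0ℤ) → offRoot f ≡ 0ℤ
    offRoot-zero f h = sumℤ-cong vanish ■ sumℤ-zero n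
      where
        vanish : ∀ w → (if does (w ≟ r) then 0ℤ else f w) ≡ 0ℤ
        vanish w with w ≟ r
        ... | yes _ = refl
        ... | no w≢r = h w w≢r

module Realise (G : RibbonDigraph) where
  open RibbonDigraph G
  open RotorOrbit G
  open Firing G

  Realises : (Fin n → ℕ) → DRC G → Set
  Realises k c = Σ (DRC G) λ d → Star (RoutesTo G) c d × config d ≋ fire k (config c)

  route-times : ∀ v j (c : DRC G) → Realises (λ u → δ v u * j) c
  route-times v zero c = c , done , ≋-sym (≋-trans (fire-cong {c = config c} (λ u → *-zeroʳ (δ v u)) ≋-refl) (fire-zero (config c)))
  route-times v (suc j) c with route-times v j c
  ... | d , c→d , d≋ =
    route G v d , c→d ◅◅ ((v , refl) ◅ done) ,
    ≋-trans (route≋fire v d) (≋-trans (fire-cong (λ _ → refl) d≋)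
      (≋-trans (fire-+ (δ v) (λ u → δ v u * j) (config c))
        (fire-cong {c = config c} (λ u → +-comm (δ v u * j) (δ v u) ■ sym (*-suc (δ v u) j)) ≋-refl)))

  occurrences : List (Fin n) → Fin n → ℕ
  occurrences [] u = 0
  occurrences (v ∷ vs) u = δ v u + occurrences vs u

  occurrences-all : ∀ u → occurrences (allFin n) u ≡ 1
  occurrences-all u = go id ■ sum-δ1 u
    where
      go : ∀ {k} (f : Fin k → Fin n) → occurrences (tabulate f) u ≡ sum (λ i → ⟦ u ≟ f i ⟧)
      go {zero} f = refl
      go {suc k} f = cong (λ z → ⟦ u ≟ f zero ⟧ + z) (go (λ i → f (suc i)))

  route-list : ∀ vs (k : Fin n → ℕ) c → Realises (λ u → occurrences vs u * k u) c
  route-list [] k c = c , done , ≋-sym (fire-zero (config c))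
  route-list (v ∷ vs) k c with route-times v (k v) c
  ... | d₁ , c→d₁ , d₁≋ with route-list vs k d₁
  ... | d , d₁→d , d≋ =
    d , c→d₁ ◅◅ d₁→d ,
    ≋-trans d≋ (≋-trans (fire-cong (λ _ → refl) d₁≋)
      (≋-trans (fire-+ (λ u → occurrences vs u * k u) (λ u → δ v u * k v) (config c))
        (fire-cong {c = config c} combine ≋-refl)))
    where
      combine : ∀ u → δ v u * k v + occurrences vs u * k u ≡ (δ v u + occurrences vs u) * k u
      combine u with u ≟ v
      ... | yes refl = sym (*-distribʳ-+ (k u) 1 (occurrences vs u))
      ... | no _ = refl

  realise : ∀ (k : Fin n → ℕ) c → Realises k c
  realise k c with route-list (allFin n) k c
  ... | d , c→d , d≋ = d , c→d , ≋-trans d≋ (fire-cong {c = config c} (λ u → cong (_* k u) (occurrences-all u) ■ *-identityˡ (k u)) ≋-refl)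

module Distance {n m : ℕ} (src tgt : Fin m → Fin n) (r : Fin n) where
  Within : ℕ → Fin n → Set
  Within zero v = v ≡ r
  Within (suc l) v = v ≡ r ⊎ Σ (Fin m) λ ε → src ε ≡ v × Within l (tgt ε)

  within? : ∀ l v → Dec (Within l v)
  within? zero v = v ≟ r
  within? (suc l) v = (v ≟ r) ⊎-dec any? (λ ε → (src ε ≟ v) ×-dec within? l (tgt ε))

  module _ (reach : ∀ v → Σ ℕ λ l → Within l v) where
    private
      shortest : ∀ v → Least (λ l → Within l v) (λ l → within? l v)
      shortest v = least (λ l → Within l v) (λ l → within? l v) (proj₁ (reach v)) (proj₂ (reach v))

      descend : ∀ v (L : Least (λ l → Within l v) (λ l → within? l v)) → v ≢ r →
                Σ (Fin m) λ ε → src ε ≡ v × proj₁ (shortest (tgt ε)) < proj₁ L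
      descend v (zero , v≡r , _) v≢r = ⊥-elim (v≢r v≡r)
      descend v (suc l , inj₁ v≡r , _) v≢r = ⊥-elim (v≢r v≡r)
      descend v (suc l , inj₂ (ε , src≡v , within) , _) v≢r =
        ε , src≡v , s≤s (proj₂ (proj₂ (shortest (tgt ε))) l within)

    dist : Fin n → ℕ
    dist v = proj₁ (shortest v)

    dist-step : ∀ v → v ≢ r → Σ (Fin m) λ ε → src ε ≡ v × dist (tgt ε) < dist v
    dist-step v = descend v (shortest v)

module Distances (D : Digraph) (sc : StronglyConnected D) (r : Fin (Digraph.n D)) where
  open Digraph D

  module To = Distance tail head r
  module From = Distance head tail r

  reach-to : ∀ v → Σ ℕ λ l → To.Within l v
  reach-to v = go (sc v r) (0 , refl)
    where
      go : ∀ {u w} → Reach D u w → Σ ℕ (λ l → To.Within l w) → Σ ℕ (λ l → To.Within l u)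
      go here found = found
      go (step ε p refl) (l , within) = go p (suc l , inj₂ (ε , refl , within))

  reach-from : ∀ v → Σ ℕ λ l → From.Within l v
  reach-from v = go (sc r v)
    where
      go : ∀ {w} → Reach D r w → Σ ℕ (λ l → From.Within l w)
      go here = 0 , refl
      go (step ε p refl) with go p
      ... | l , within = suc l , inj₂ (ε , refl , within)

  distTo distFrom : Fin n → ℕ
  distTo = To.dist reach-to
  distFrom = From.dist reach-from

  distTo-step : ∀ v → v ≢ r → Σ (Fin m) λ ε → tail ε ≡ v × distTo (head ε) < distTo v
  distTo-step = To.dist-step reach-to

  distFrom-step : ∀ v → v ≢ r → Σ (Fin m) λ ε → head ε ≡ v × distFrom (tail ε) < distFrom v
  distFrom-step = From.dist-step reach-from

x+∣x∣≥0 : ∀ x → 0ℤ ≤ℤ x +ℤ + ∣ x ∣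
x+∣x∣≥0 (+ n) = +≤+ z≤n
x+∣x∣≥0 -[1+ n ] = ℤP.≤-reflexive (sym (ℤP.+-inverseˡ (+ suc n)))

add-enough : ∀ x R → suc ∣ x ∣ ≤ R → 1ℤ ≤ℤ x +ℤ + R
add-enough x R enough =
  ℤP.≤-trans (subst (_≤ℤ x +ℤ + ∣ x ∣ +ℤ 1ℤ) (ℤP.+-identityˡ 1ℤ) (ℤP.+-monoˡ-≤ 1ℤ (x+∣x∣≥0 x)))
    (ℤP.≤-trans (ℤP.≤-reflexive (regroup x (+ ∣ x ∣) ■ cong (x +ℤ_) (sym (ℤP.pos-+ 1 ∣ x ∣))))
      (ℤP.+-monoʳ-≤ x (+≤+ enough)))
  where
    regroup : ∀ a b → a +ℤ b +ℤ 1ℤ ≡ a +ℤ (1ℤ +ℤ b)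
    regroup = solveℤ

-- Vertex u
-- makes M u = B ^ (D - distFrom u) turns; a vertex v ≠ r has an in-neighbour
-- closer to r, which makes B times as many turns as v and so sends v more than
-- v itself sends out plus |x v|.
module Saturation (G : RibbonDigraph) (sc : StronglyConnected (RibbonDigraph.graph G)) (r : Fin (RibbonDigraph.n G)) where
  open RibbonDigraph G
  open RotorOrbit G
  open Firing G
  open Distances graph sc r

  module _ (x : Fin n → ℤ) where
    B : ℕ
    B = suc (sum (λ u → d⁺ u + ∣ x u ∣))

    M : Fin n → ℕ
    M u = B ^ (sum distFrom ∸ distFrom u)

    M≥1 : ∀ u → 1 ≤ M u
    M≥1 u = m^n>0 B (sum distFrom ∸ distFrom u)

    B-large : ∀ v → suc (d⁺ v + ∣ x v ∣) ≤ B
    B-large v = s≤s (term≤sum (λ u → d⁺ u + ∣ x u ∣) v)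

    M-closer : ∀ v t → distFrom t < distFrom v → B * M v ≤ M t
    M-closer v t closer = ^-monoʳ-≤ B (∸-monoʳ-< closer (term≤sum distFrom v))

    inflow : Fin n → ℕ
    inflow v = sum (λ ε → ⟦ head ε ≟ v ⟧ * M (tail ε))

    inflow-large : ∀ v → v ≢ r → M v * d⁺ v + suc ∣ x v ∣ ≤ inflow v
    inflow-large v v≢r = ≤-trans own-turns (≤-trans (≤-trans (*-monoˡ-≤ (M v) (B-large v)) (M-closer v (tail ε) closer)) via-ε)
      where
        ε = proj₁ (distFrom-step v v≢r)
        into-v = proj₁ (proj₂ (distFrom-step v v≢r))
        closer = proj₂ (proj₂ (distFrom-step v v≢r))
        a = ∣ x v ∣
        own-turns : M v * d⁺ v + suc a ≤ suc (d⁺ v + a) * M v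
        own-turns = begin
          M v * d⁺ v + suc a           ≡⟨ +-suc (M v * d⁺ v) a ⟩
          suc (M v * d⁺ v + a)         ≤⟨ s≤s (+-monoʳ-≤ (M v * d⁺ v) (m≤m*n a (M v) ⦃ >-nonZero (M≥1 v) ⦄)) ⟩
          suc (M v * d⁺ v + a * M v)   ≤⟨ +-monoˡ-≤ (M v * d⁺ v + a * M v) (M≥1 v) ⟩
          M v + (M v * d⁺ v + a * M v) ≡⟨ cong (λ z → M v + (z + a * M v)) (*-comm (M v) (d⁺ v)) ⟩
          M v + (d⁺ v * M v + a * M v) ≡⟨ cong (λ z → M v + z) (sym (*-distribʳ-+ (M v) (d⁺ v) a)) ⟩
          suc (d⁺ v + a) * M v         ∎
          where open ≤-Reasoning
        via-ε : M (tail ε) ≤ inflow v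
        via-ε = ≤-trans (≤-reflexive (sym (+-identityʳ (M (tail ε))) ■ cong (_* M (tail ε)) (sym (⟦⟧-yes (head ε ≟ v) into-v))))
                  (term≤sum (λ ε′ → ⟦ head ε′ ≟ v ⟧ * M (tail ε′)) ε)

    saturated : ∀ v → v ≢ r → 1ℤ ≤ℤ x v -ℤ + (M v * d⁺ v) +ℤ + inflow v
    saturated v v≢r = subst (1ℤ ≤ℤ_) (sym chips) (add-enough (x v) surplus surplus-large)
      where
        out = M v * d⁺ v
        surplus = inflow v ∸ out
        inflow≡ : inflow v ≡ out + surplus
        inflow≡ = sym (m+[n∸m]≡n (≤-trans (m≤m+n out (suc ∣ x v ∣)) (inflow-large v v≢r)))
        surplus-large : suc ∣ x v ∣ ≤ surplus
        surplus-large = subst (_≤ surplus) (m+n∸m≡n out (suc ∣ x v ∣)) (∸-monoˡ-≤ out (inflow-large v v≢r))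
        chips : x v -ℤ + out +ℤ + inflow v ≡ x v +ℤ + surplus
        chips = cong (λ z → x v -ℤ + out +ℤ + z) inflow≡ ■ cong (λ z → x v -ℤ + out +ℤ z) (ℤP.pos-+ out surplus)
                ■ cancel (x v) (+ out) (+ surplus)
          where
            cancel : ∀ x a s → x -ℤ a +ℤ (a +ℤ s) ≡ x +ℤ s
            cancel = solveℤ

  saturate : ∀ x ρ → IsRotor ρ → Σ (Fin n → ℕ) λ k →
             (∀ v → v ≢ r → 1ℤ ≤ℤ proj₁ (fire k (x , ρ)) v) × (∀ u → proj₂ (fire k (x , ρ)) u ≡ ρ u)
  saturate x ρ t = (λ u → M x u * d⁺ u) ,
                   (λ v v≢r → subst (1ℤ ≤ℤ_) (sym (proj₁ turns v)) (saturated x v v≢r)) , proj₂ turns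
    where
      turns = fire-turns (M x) x ρ t

module SingleRouting (G : RibbonDigraph) (noloop : NoLoops (RibbonDigraph.graph G))
                     (c : DRC G) (v : Fin (RibbonDigraph.n G)) where
  open RibbonDigraph G
  open Firing G using (ind≡⟦⟧)
  open RotorWalk G

  x x′ : Fin n → ℤ
  x = proj₁ c
  x′ = proj₁ (route G v c)
  ρ ρ′ : Fin n → Fin m
  ρ = Rotor.ρ (proj₂ c)
  ρ′ = Rotor.ρ (proj₂ (route G v c))

  v′ : Fin n
  v′ = head (next (ρ v))

  v′≢v : v′ ≢ v
  v′≢v eq = noloop (next (ρ v)) (next-tail (ρ v) ■ Rotor.ρ-tail (proj₂ c) v ■ sym eq)

  x′≡ : ∀ w → x′ w ≡ x w -ℤ + ⟦ w ≟ v ⟧ +ℤ + ⟦ w ≟ v′ ⟧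
  x′≡ w = cong₂ (λ s t → x w -ℤ s +ℤ t) (ind≡⟦⟧ v w) (ind≡⟦⟧ v′ w)

  follow-other : ∀ a → a ≢ v → follow ρ′ a ≡ follow ρ a
  follow-other a a≢v = cong head (if-no (a ≟ v) a≢v)

  follow-v : follow ρ′ v ≡ v′
  follow-v = cong head (if-yes (v ≟ v) refl)

  x′-other : ∀ a → a ≢ v → x a ≤ℤ x′ a
  x′-other a a≢v = subst (x a ≤ℤ_) (sym (x′≡ a ■ cong (λ z → x a -ℤ + z +ℤ + ⟦ a ≟ v′ ⟧) (⟦⟧-no (a ≟ v) a≢v) ■ drop0 (x a) _))
                     (le-add (x a) (+≤+ z≤n))
    where
      drop0 : ∀ a b → a -ℤ 0ℤ +ℤ b ≡ a +ℤ b
      drop0 = solveℤ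

  x′-receiver : 0ℤ ≤ℤ x v′ → 0ℤ <ℤ x′ v′
  x′-receiver h = subst (0ℤ <ℤ_) (sym (x′≡ v′ ■ cong₂ (λ a b → x v′ -ℤ + a +ℤ + b) (⟦⟧-no (v′ ≟ v) v′≢v) (⟦⟧-yes (v′ ≟ v′) refl)
                                         ■ plus-one (x v′)))
                    (ℤP.suc[i]≤j⇒i<j (ℤP.+-monoˡ-≤ 1ℤ h))
    where
      plus-one : ∀ a → a -ℤ 0ℤ +ℤ 1ℤ ≡ a +ℤ 1ℤ
      plus-one = solveℤ

  x′-sender : 0ℤ <ℤ x v → 0ℤ ≤ℤ x′ v
  x′-sender h = subst (0ℤ ≤ℤ_) (sym (x′≡ v ■ cong₂ (λ a b → x v -ℤ + a +ℤ + b) (⟦⟧-yes (v ≟ v) refl) (⟦⟧-no (v ≟ v′) (λ eq → v′≢v (sym eq)))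
                                         ■ ℤP.+-identityʳ _))
                  (ℤP.i≤j⇒0≤j-i (ℤP.i<j⇒suc[i]≤j h))

-- Stabilisation: from a configuration with a chip on every v ≠ r, repeatedly
-- route some v ≠ r holding a chip.  Chips away from r stay nonnegative, and the
-- rotor walk from every vertex reaches r or a vertex holding a chip.  The total
-- number of routings is bounded, so the process stops with no chip away from r,
-- and then the rotor walk from every vertex reaches r.
module Stabilisation (G : RibbonDigraph) (noloop : NoLoops (RibbonDigraph.graph G))
                     (sc : StronglyConnected (RibbonDigraph.graph G)) (r : Fin (RibbonDigraph.n G)) where
  open RibbonDigraph G
  open RotorOrbit G
  open Firing G
  open RootedRotors G r
  open Degree G
  open OffRoot r
  open Distances graph sc r

  d⁺≤m : ∀ u → d⁺ u ≤ m
  d⁺≤m u = subst (_≤ m) (sym (d⁺-sum u)) (subst (sum (λ ε → ⟦ tail ε ≟ u ⟧) ≤_) (sum-ones {m}) (sum-mono-≤ (λ ε → ⟦⟧≤1 (tail ε ≟ u))))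

  LeadsToChip : DRC G → Set
  LeadsToChip (x , rot) = ∀ a → Σ ℕ λ j → iter (follow (Rotor.ρ rot)) j a ≡ r ⊎ 0ℤ <ℤ x (iter (follow (Rotor.ρ rot)) j a)

  module _ (c₁ : DRC G) (c₁-chips : ∀ v → v ≢ r → 1ℤ ≤ℤ proj₁ c₁ v) where
    x₁ : Fin n → ℤ
    x₁ = proj₁ c₁
    ρ₁ : Fin n → Fin m
    ρ₁ = Rotor.ρ (proj₂ c₁)

    x₁-nonneg : ∀ v → v ≢ r → 0ℤ ≤ℤ x₁ v
    x₁-nonneg v v≢r = ℤP.≤-trans (+≤+ z≤n) (c₁-chips v v≢r)

    S : ℕ
    S = ∣ offRoot x₁ ∣
    S≡ : + S ≡ offRoot x₁
    S≡ = ℤP.0≤i⇒+∣i∣≡i (offRoot-nonneg x₁ x₁-nonneg)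

    -- a vertex at distance l from r routes at most β l times
    β : ℕ → ℕ
    β zero = 0
    β (suc l) = suc (β l + S) * m

    bound : ℕ
    bound = sum (λ u → β (distTo u))

    -- Bounding the routings of a sequence from c₁ that never routes r and keeps
    -- chips away from r nonnegative: a vertex receives at most S chips more than
    -- it routes, and every d⁺ u ≤ m routings of u send a chip one step closer to r.
    module _ {c : DRC G} (path : Star (RoutesTo G) c₁ c) (k : Fin n → ℕ) (fired : config c ≋ fire k (config c₁))
             (root-idle : k r ≡ 0) (nonneg : ∀ v → v ≢ r → 0ℤ ≤ℤ proj₁ c v) where
      private
        x : Fin n → ℤ
        x = proj₁ c
        chips : ∀ w → x w ≡ x₁ w -ℤ + k w +ℤ + received k ρ₁ w
        chips = proj₁ fired

      chip-balance : offRoot x +ℤ + received k ρ₁ r ≡ + S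
      chip-balance = solve-balance (x r) (x₁ r) (offRoot x) (+ received k ρ₁ r) (offRoot x₁)
                       (chips r ■ cong (λ z → x₁ r -ℤ + z +ℤ + received k ρ₁ r) root-idle)
                       (sym (sum≡root+offRoot x) ■ routes-preserve-deg path ■ sum≡root+offRoot x₁)
                     ■ sym S≡
        where
          solve-balance : ∀ a b c i s → a ≡ b -ℤ 0ℤ +ℤ i → a +ℤ c ≡ b +ℤ s → c +ℤ i ≡ s
          solve-balance a b c i s h₁ h₂ = regroup b c i ■ cong (λ z → z +ℤ c -ℤ b) (sym h₁) ■ cong (_-ℤ b) h₂ ■ cancel b s
            where
              regroup : ∀ b c i → c +ℤ i ≡ (b -ℤ 0ℤ +ℤ i) +ℤ c -ℤ b
              regroup = solveℤ
              cancel : ∀ b s → b +ℤ s -ℤ b ≡ s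
              cancel = solveℤ

      received-bound : ∀ w → received k ρ₁ w ≤ k w + S
      received-bound w with w ≟ r
      ... | yes refl = ≤-trans (ℤP.drop‿+≤+ (subst (+ received k ρ₁ w ≤ℤ_) chip-balance
                                                  (le-addˡ (+ received k ρ₁ w) (offRoot-nonneg x nonneg))))
                               (m≤n+m S (k w))
      ... | no w≢r = subst (received k ρ₁ w ≤_) (+-comm S (k w)) (ℤP.drop‿+≤+ chain)
        where
          rearrange : ∀ a b c d → a ≡ b -ℤ c +ℤ d → d +ℤ b ≡ a +ℤ c
          rearrange a b c d h = regroup b c d ■ cong (_+ℤ c) (sym h)
            where
              regroup : ∀ b c d → d +ℤ b ≡ b -ℤ c +ℤ d +ℤ c
              regroup = solveℤ
          xw≤S : x w ≤ℤ + S
          xw≤S = ℤP.≤-trans (term≤offRoot x nonneg w w≢r)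
                   (subst (offRoot x ≤ℤ_) chip-balance (le-add (offRoot x) (+≤+ z≤n)))
          chain : + received k ρ₁ w ≤ℤ + (S + k w)
          chain = ℤP.≤-trans (le-add (+ received k ρ₁ w) (x₁-nonneg w w≢r))
                   (ℤP.≤-trans (ℤP.≤-reflexive (rearrange (x w) (x₁ w) (+ k w) (+ received k ρ₁ w) (chips w)))
                     (subst (x w +ℤ + k w ≤ℤ_) (sym (ℤP.pos-+ S (k w))) (ℤP.+-monoˡ-≤ (+ k w) xw≤S)))

      routings-by-distance : ∀ l u → distTo u ≤ l → k u ≤ β l
      routings-by-distance l u near with u ≟ r
      ... | yes refl = subst (_≤ β l) (sym root-idle) z≤n
      ... | no u≢r with distTo-step u u≢r
      ... | ε , tail≡u , closer with l
      ...   | zero = ⊥-elim (n≮0 (≤-trans closer near))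
      ...   | suc l′ = <⇒≤ (≤-trans (routings<passes (ρ₁ u) (k u) ε (tail≡u ■ sym (Rotor.ρ-tail (proj₂ c₁) u)))
                                     (*-mono-≤ (s≤s passes-bound) (d⁺≤m _)))
        where
          w = head ε
          passes-bound : passes (ρ₁ u) (k u) ε ≤ β l′ + S
          passes-bound = begin
            passes (ρ₁ u) (k u) ε                ≡⟨ cong (λ z → passes (ρ₁ z) (k z) ε) (sym tail≡u) ⟩
            sent k ρ₁ ε                          ≡⟨ sym (+-identityʳ _) ■ cong (_* sent k ρ₁ ε) (sym (⟦⟧-yes (head ε ≟ w) refl)) ⟩
            ⟦ head ε ≟ w ⟧ * sent k ρ₁ ε          ≤⟨ term≤sum (λ ε′ → ⟦ head ε′ ≟ w ⟧ * sent k ρ₁ ε′) ε ⟩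
            received k ρ₁ w                      ≤⟨ received-bound w ⟩
            k w + S                              ≤⟨ +-monoˡ-≤ S (routings-by-distance l′ w (≤-pred (≤-trans closer near))) ⟩
            β l′ + S                             ∎
            where open ≤-Reasoning

      routing-bound : sum k ≤ bound
      routing-bound = sum-mono-≤ (λ u → routings-by-distance (distTo u) u ≤-refl)

    record Reached (c : DRC G) : Set where
      field
        path : Star (RoutesTo G) c₁ c
        k : Fin n → ℕ
        fired : config c ≋ fire k (config c₁)
        root-idle : k r ≡ 0
        nonneg : ∀ v → v ≢ r → 0ℤ ≤ℤ proj₁ c v
        leads : LeadsToChip c

    start : Reached c₁
    start = record { path = done ; k = λ _ → 0 ; fired = ≋-sym (fire-zero (config c₁)) ; root-idle = refl
                   ; nonneg = x₁-nonneg ; leads = λ a → 0 , here-or-chip a }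
      where
        here-or-chip : ∀ a → a ≡ r ⊎ 0ℤ <ℤ x₁ a
        here-or-chip a with a ≟ r
        ... | yes a≡r = inj₁ a≡r
        ... | no a≢r = inj₂ (ℤP.suc[i]≤j⇒i<j (c₁-chips a a≢r))

    route-step : ∀ c v → v ≢ r → 0ℤ <ℤ proj₁ c v → Reached c → Reached (route G v c)
    route-step c v v≢r has-chip s = record
      { path = Reached.path s ◅◅ ((v , refl) ◅ done)
      ; k = λ u → Reached.k s u + δ v u
      ; fired = ≋-trans (route≋fire v c) (≋-trans (fire-cong (λ _ → refl) (Reached.fired s)) (fire-+ (δ v) (Reached.k s) (config c₁)))
      ; root-idle = cong₂ _+_ (Reached.root-idle s) (⟦⟧-no (r ≟ v) (λ eq → v≢r (sym eq)))
      ; nonneg = nonneg′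
      ; leads = λ a → preserved (proj₁ (Reached.leads s a)) a (proj₂ (Reached.leads s a))
      }
      where
        open SingleRouting G noloop c v
        nonneg′ : ∀ w → w ≢ r → 0ℤ ≤ℤ x′ w
        nonneg′ w w≢r = by-cases (w ≟ v)
          where
            by-cases : Dec (w ≡ v) → 0ℤ ≤ℤ x′ w
            by-cases (yes w≡v) = subst (λ z → 0ℤ ≤ℤ x′ z) (sym w≡v) (x′-sender has-chip)
            by-cases (no w≢v) = ℤP.≤-trans (Reached.nonneg s w w≢r) (x′-other w w≢v)
        Target : Fin n → (Fin n → ℤ) → Set
        Target a y = a ≡ r ⊎ 0ℤ <ℤ y a
        -- the walk from v now goes to v′, which is r or has just received a chip
        from-v : Σ ℕ λ j → Target (iter (follow ρ′) j v) x′
        from-v with v′ ≟ r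
        ... | yes v′≡r = 1 , inj₁ (follow-v ■ v′≡r)
        ... | no v′≢r = 1 , inj₂ (subst (λ z → 0ℤ <ℤ x′ z) (sym follow-v) (x′-receiver (Reached.nonneg s v′ v′≢r)))
        -- a walk avoiding v is unchanged, and its chip is not routed away
        preserved : ∀ j a → Target (iter (follow ρ) j a) x → Σ ℕ λ j′ → Target (iter (follow ρ′) j′ a) x′
        preserved j a h with a ≟ v
        ... | yes refl = from-v
        preserved zero a (inj₁ a≡r) | no a≢v = 0 , inj₁ a≡r
        preserved zero a (inj₂ chip) | no a≢v = 0 , inj₂ (ℤP.<-≤-trans chip (x′-other a a≢v))
        preserved (suc j) a h | no a≢v with preserved j (follow ρ a) (subst (λ z → Target z x) (iter-suc (follow ρ) j a) h)
        ... | j′ , h′ = suc j′ , subst (λ z → Target z x′) (sym (iter-suc (follow ρ′) j′ a ■ cong (iter (follow ρ′) j′) (follow-other a a≢v))) h′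

    Stable : Set
    Stable = Σ (DRC G) λ d → Star (RoutesTo G) c₁ d × (∀ v → v ≢ r → proj₁ d v ≡ 0ℤ) ×
               ReachesRoot (Rotor.ρ (proj₂ d)) × Rotor.ρ (proj₂ d) r ≡ ρ₁ r

    finished : ∀ c → Reached c → ¬ (Σ (Fin n) λ v → v ≢ r × 0ℤ <ℤ proj₁ c v) → Stable
    finished c s none = c , Reached.path s , no-chips , reaches , root-rotor
      where
        x = proj₁ c
        ρ = Rotor.ρ (proj₂ c)
        no-chips : ∀ v → v ≢ r → x v ≡ 0ℤ
        no-chips v v≢r = ℤP.≤-antisym (ℤP.≮⇒≥ (λ chip → none (v , v≢r , chip))) (Reached.nonneg s v v≢r)
        reaches : ReachesRoot ρ
        reaches a with Reached.leads s a
        ... | j , inj₁ hit = j , hit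
        ... | j , inj₂ chip with iter (follow ρ) j a ≟ r
        ...   | yes hit = j , hit
        ...   | no miss = ⊥-elim (none (_ , miss , chip))
        root-rotor : ρ r ≡ ρ₁ r
        root-rotor = proj₂ (Reached.fired s) r ■ cong (λ z → turn z (ρ₁ r)) (Reached.root-idle s)

    -- `fuel` exceeds the number of routings still possible
    run : ∀ fuel c → (s : Reached c) → bound < fuel + sum (Reached.k s) → Stable
    run fuel c s enough with any? (λ v → ¬? (v ≟ r) ×-dec (0ℤ <ℤ? proj₁ c v))
    ... | no none = finished c s none
    ... | yes (v , v≢r , chip) with fuel
    ...   | zero = ⊥-elim (<⇒≱ enough (routing-bound (Reached.path s) (Reached.k s) (Reached.fired s)
                                            (Reached.root-idle s) (Reached.nonneg s)))
    ...   | suc fuel′ = run fuel′ (route G v c) s′ (subst (bound <_) (sym (cong (λ z → fuel′ + z) one-more ■ +-suc fuel′ _)) enough)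
      where
        s′ = route-step c v v≢r chip s
        one-more : sum (Reached.k s′) ≡ suc (sum (Reached.k s))
        one-more = ∑-distrib-+ (Reached.k s) (δ v) ■ cong (λ z → sum (Reached.k s) + z) (sum-cong-≗ (λ u → ⟦≟⟧-sym u v) ■ sum-δ1 v)
                   ■ +-comm _ 1

    stabilise : Stable
    stabilise = run (suc bound) c₁ start
                  (subst (bound <_) (sym (+-identityʳ (suc bound)) ■ cong (λ z → suc bound + z) (sym (sum-replicate-zero n))) ≤-refl)

module Existence (G : RibbonDigraph) (noloop : NoLoops (RibbonDigraph.graph G))
                 (sc : StronglyConnected (RibbonDigraph.graph G))
                 (r : Fin (RibbonDigraph.n G)) (e : Fin (RibbonDigraph.m G)) (e-from-r : RibbonDigraph.tail G e ≡ r) where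
  open RibbonDigraph G
  open RotorOrbit G
  open Firing G
  open Realise G
  open RootedRotors G r
  open Degree G
  open OffRoot r

  ρ-of : DRC G → Fin n → Fin m
  ρ-of c = Rotor.ρ (proj₂ c)

  aim-root : ∀ c → Σ (DRC G) λ c₀ → Star (RoutesTo G) c c₀ × ρ-of c₀ r ≡ e
  aim-root c with next-cyc (ρ-of c r) e (Rotor.ρ-tail (proj₂ c) r ■ sym e-from-r)
  ... | j , turned with route-times r j c
  ... | c₀ , c→c₀ , c₀≋ = c₀ , c→c₀ ,
        (proj₂ c₀≋ r ■ cong (λ z → turn (z * j) (ρ-of c r)) (⟦⟧-yes (r ≟ r) refl) ■ cong (λ z → turn z (ρ-of c r)) (+-identityʳ j) ■ turned)

  -- Give every v ≠ r a chip by whole turns, which keep all rotors.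
  saturate-config : ∀ c₀ → Σ (DRC G) λ c₁ → Star (RoutesTo G) c₀ c₁ ×
                      (∀ v → v ≢ r → 1ℤ ≤ℤ proj₁ c₁ v) × ρ-of c₁ r ≡ ρ-of c₀ r
  saturate-config c₀ with Saturation.saturate G sc r (proj₁ c₀) (ρ-of c₀) (Rotor.ρ-tail (proj₂ c₀))
  ... | k , chips , rotors-kept with realise k c₀
  ... | c₁ , c₀→c₁ , c₁≋ = c₁ , c₀→c₁ , (λ v v≢r → subst (1ℤ ≤ℤ_) (sym (proj₁ c₁≋ v)) (chips v v≢r)) ,
                           (proj₂ c₁≋ r ■ rotors-kept r)

  stable⇒good : ∀ c d → deg G (proj₁ c) ≡ 0ℤ → Star (RoutesTo G) c d → (∀ v → v ≢ r → proj₁ d v ≡ 0ℤ) →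
                ReachesRoot (ρ-of d) → ρ-of d r ≡ e → Good G r e d
  stable⇒good c d deg0 c→d off-root-empty reach root-rotor =
    no-chips , root-rotor , reachesRoot⇒arborescence (proj₂ d) reach
    where
      x = proj₁ d
      total : sumℤ x ≡ 0ℤ
      total = routes-preserve-deg c→d ■ sym (foldr≡sumℤ (proj₁ c)) ■ deg0
      no-chips : ∀ v → x v ≡ 0ℤ
      no-chips v with v ≟ r
      ... | no v≢r = off-root-empty v v≢r
      ... | yes refl = sym (ℤP.+-identityʳ (x r)) ■ cong (x r +ℤ_) (sym (offRoot-zero x off-root-empty))
                       ■ sym (sum≡root+offRoot x) ■ total

  existence : ∀ c → deg G (proj₁ c) ≡ 0ℤ → Σ (DRC G) λ d → Good G r e d × LinEquiv G c d
  existence c deg0 with aim-root c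
  ... | c₀ , c→c₀ , aimed with saturate-config c₀
  ... | c₁ , c₀→c₁ , saturated , kept with Stabilisation.stabilise G noloop sc r c₁ saturated
  ... | d , c₁→d , off-root-empty , reach , root-rotor =
    d , stable⇒good c d deg0 c→d off-root-empty reach (root-rotor ■ kept ■ aimed) , inj₁ c→d
    where
      c→d = c→c₀ ◅◅ c₀→c₁ ◅◅ c₁→d

lemma3p17 : (G : RibbonDigraph) →
    NoLoops (RibbonDigraph.graph G) →
    StronglyConnected (RibbonDigraph.graph G) →
    Eulerian (RibbonDigraph.graph G) →
    (r : Fin (RibbonDigraph.n G)) (e : Fin (RibbonDigraph.m G)) →
    RibbonDigraph.tail G e ≡ r →
    (c : DRC G) → deg G (proj₁ c) ≡ 0ℤ →
    (Σ (DRC G) λ d → Good G r e d × LinEquiv G c d) ×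
    (∀ d d′ → Good G r e d → LinEquiv G c d → Good G r e d′ → LinEquiv G c d′ →
      _≈DRC_ G d d′)
lemma3p17 G noloop sc eul r e e-from-r c deg0 =
  Existence.existence G noloop sc r e e-from-r c deg0 ,
  Uniqueness.uniqueness G eul r e c
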